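{- Let $\mathcal{U}$ be a nonprincipal ultrafilter on $\mathbb{N}$. For each $k \in \mathbb{N}$ let $q_k$ be a power of a prime, and assume $\lim_{k\to\infty} q_k = \infty$. Let $\mathbb{F}_{\bar{q}} = \prod_{k\in\mathbb{N}} \mathbb{F}_{q_k}/\mathcal{U}$ be the ultraproduct of the finite fields $\mathbb{F}_{q_k}$. Fix a positive integer $n$, and let $p_1,\dots,p_r$ be the prime divisors of $n$. Then the following conditions are equivalent: (1) for every choice of elements $g_k \in \mathbb{F}_{q_k}$ such that each $g_k$ is a generator of the cyclic group $\mathbb{F}_{q_k}^\times$, the binomial $x^n - g$ is irreducible over $\mathbb{F}_{\bar{q}}$, where $g \in \mathbb{F}_{\bar{q}}$ is the class of the sequence $(g_k)_{k\in\mathbb{N}}$ modulo $\mathcal{U}$; (2) there exists $g \in \mathbb{F}_{\bar{q}}$ such that $x^n - g$ is irreducible over $\mathbb{F}_{\bar{q}}$; (3) the set of $k \in \mathbb{N}$ such that $p_1, p_2, \dots, p_r$ all divide $q_k - 1$ and, if $4 \mid n$, also $4 \mid q_k - 1$, belongs to $\mathcal{U}$.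
   Context: $\mathbb{F}_{q}$ denotes the finite field with $q$ elements and $\mathbb{F}_q^\times$ its multiplicative group. The ultraproduct $\prod_{k} \mathbb{F}_{q_k}/\mathcal{U}$ is the quotient of the product ring by the equivalence relation identifying sequences that agree on a set in $\mathcal{U}$; it is a field (a pseudofinite field). -}

module Defs where

open import Level using (0ℓ)
open import Algebra.Bundles using (CommutativeRing)
open import Data.Nat using (ℕ; zero; suc; _+_; _∸_; _^_; _≤_; _<_; _≟_)
open import Data.Nat.Divisibility using (_∣_)
open import Data.Nat.Primality using (Prime)
open import Data.Fin using (Fin)
open import Data.Product using (Σ; ∃; _×_; _,_)
open import Data.Sum using (_⊎_)
open import Data.Empty using (⊥)
open import Data.Unit using (⊤)
open import Relation.Nullary using (¬_; yes; no)
open import Relation.Binary.PropositionalEquality using (_≡_; _≢_)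

_⊆_ : (ℕ → Set) → (ℕ → Set) → Set
A ⊆ B = ∀ k → A k → B k

record Ultrafilter : Set₁ where
  field
    _∈U       : (ℕ → Set) → Set
    full      : (λ _ → ⊤) ∈U
    nonempty  : ¬ ((λ _ → ⊥) ∈U)
    upward    : ∀ {A B} → A ⊆ B → A ∈U → B ∈U
    inter     : ∀ {A B} → A ∈U → B ∈U → (λ k → A k × B k) ∈U
    ultra     : ∀ A → A ∈U ⊎ (λ k → ¬ A k) ∈U

NonPrincipal : Ultrafilter → Set
NonPrincipal U = ∀ m → ¬ ((λ k → k ≡ m) ∈U)
  where open Ultrafilter U

record Field : Set₁ where
  field
    commRing : CommutativeRing 0ℓ 0ℓ
  open CommutativeRing commRing public
  field
    0≉1     : ¬ (0# ≈ 1#)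
    inverse : ∀ x → ¬ (x ≈ 0#) → Σ Carrier λ y → (x * y) ≈ 1#

HasSize : Field → ℕ → Set
HasSize F q = Σ (Fin q → Carrier) λ e →
                (∀ i j → e i ≈ e j → i ≡ j) × (∀ x → ∃ λ i → e i ≈ x)
  where open Field F

pow : (F : Field) → Field.Carrier F → ℕ → Field.Carrier F
pow F x zero    = Field.1# F
pow F x (suc i) = Field._*_ F x (pow F x i)

IsGenerator : (F : Field) → Field.Carrier F → Set
IsGenerator F g = ¬ (g ≈ 0#) × (∀ x → ¬ (x ≈ 0#) → ∃ λ i → pow F g i ≈ x)
  where open Field F

IsPrimePower : ℕ → Set
IsPrimePower q = Σ ℕ λ p → Σ ℕ λ e → Prime p × 1 ≤ e × q ≡ p ^ e

TendsToInfinity : (ℕ → ℕ) → Set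
TendsToInfinity q = ∀ M → ∃ λ N → ∀ k → N ≤ k → M ≤ q k

-- The ultraproduct ∏ F k / U, presented as a setoid on representatives
-- with pointwise ring operations.

module Ultraproduct (U : Ultrafilter) (F : ℕ → Field) where
  open Ultrafilter U
  open Field using (Carrier; 0#; 1#)

  UP : Set
  UP = (k : ℕ) → Carrier (F k)

  infix 4 _≈ᵤ_
  _≈ᵤ_ : UP → UP → Set
  a ≈ᵤ b = (λ k → Field._≈_ (F k) (a k) (b k)) ∈U

  0ᵤ 1ᵤ : UP
  0ᵤ k = 0# (F k)
  1ᵤ k = 1# (F k)

  _+ᵤ_ _*ᵤ_ : UP → UP → UP
  (a +ᵤ b) k = Field._+_ (F k) (a k) (b k)
  (a *ᵤ b) k = Field._*_ (F k) (a k) (b k)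

  -ᵤ_ : UP → UP
  (-ᵤ a) k = Field.-_ (F k) (a k)

  Poly : Set
  Poly = ℕ → UP

  DegLe : Poly → ℕ → Set
  DegLe A d = ∀ j → d < j → A j ≈ᵤ 0ᵤ

  sumTo : ℕ → (ℕ → UP) → UP
  sumTo zero    f = f zero
  sumTo (suc m) f = sumTo m f +ᵤ f (suc m)

  _·_ : Poly → Poly → Poly
  (A · B) i = sumTo i (λ j → A j *ᵤ B (i ∸ j))

  -- the binomial x^n - g  (for n ≥ 1)
  binom : ℕ → UP → Poly
  binom n g i with i ≟ 0 | i ≟ n
  ... | yes _ | _ = -ᵤ g
  ... | no _ | yes _ = 1ᵤ
  ... | no _ | no _ = 0ᵤ

  -- f (of degree n) is reducible: a product of two nonconstant polynomials
  Reducible : ℕ → Poly → Set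
  Reducible n f = Σ ℕ λ a → Σ ℕ λ b → Σ Poly λ A → Σ Poly λ B →
    1 ≤ a × 1 ≤ b × a + b ≡ n × DegLe A a × DegLe B b ×
    (∀ i → (A · B) i ≈ᵤ f i)

  IrreducibleBinom : ℕ → UP → Set
  IrreducibleBinom n g = ¬ Reducible n (binom n g)

{-# OPTIONS --safe #-}
module Submission where

-- Over a field F with q elements, let g generate the unit group and suppose x^n − g = A B with
-- deg A = a < n.  In F[x]/(x^n − g) the class α of x has order n (q − 1), because every prime
-- divisor of n divides q − 1; more strongly, α^i − α^j is a non-zero-divisor unless n (q − 1)
-- divides i − j.  Since n (q − 1) ∣ q^l − 1 forces n ∣ l (lifting the exponent, which is where
-- the condition on 4 enters), the conjugates α^(q^k), k ≤ a, are a + 1 distinct zeros of A modulo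
-- the annihilator of B(α), and so the leading coefficient of A vanishes.  Conversely, if a prime
-- p ∣ n does not divide q − 1, then g is a p-th power; and if 4 ∣ n and q ≡ 3 mod 4, then every
-- element is a square up to sign, so that x^n − g is a difference of squares or an instance of
-- X⁴ + h² = (X² + s X + h)(X² − s X + h) with s² = 2h.  The ultrafilter transfers both statements,
-- fixing the degrees of the factors on a set in U.

open import Level using (0ℓ)
open import Defs
open import Algebra.Bundles using (CommutativeRing)
import Algebra.Properties.Semiring.Exp as Exp
open import Data.Nat as ℕ using (ℕ; zero; suc; _∸_; _≤_; _<_; z≤n; s≤s; NonZero; ≢-nonZero; ≢-nonZero⁻¹; _%_;
  nonTrivial⇒n>1)
import Data.Nat.Properties as ℕ
import Data.Nat.DivMod as ℕ
open import Data.Nat.Divisibility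
open import Data.Nat.Primality
open import Data.Nat.Primality.Factorisation using (factorise)
open import Data.Nat.Coprimality as Coprime using (Coprime; coprime-divisor; coprime-Bézout)
open import Data.Nat.GCD using (gcd; gcd-GCD; gcd[m,n]∣m; gcd[m,n]∣n; module Bézout)
open import Data.Nat.Induction using (<-wellFounded)
open import Data.Nat.Tactic.RingSolver using (solve-∀)
open import Data.Fin as Fin using (Fin; zero; suc; punchIn; punchOut; toℕ; fromℕ<; inject≤)
import Data.Fin.Properties as Fin
open import Data.Fin.Permutation using (permutation)
open import Data.List using ([]; _∷_)
open import Data.List.Relation.Unary.All using (_∷_)
open import Data.Product using (∃; _×_; _,_; proj₁; proj₂)
open import Data.Sum using (_⊎_; inj₁; inj₂)
open import Data.Empty using (⊥; ⊥-elim)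
open import Function using (_∘_; id)
open import Function.Bundles using (_⇔_; mk⇔)
open import Induction.WellFounded using (Acc; acc)
open import Relation.Binary.Definitions using (tri<; tri≈; tri>)
open import Relation.Binary.PropositionalEquality as ≡ using (_≡_; _≢_)
open import Relation.Nullary using (¬_; Dec; yes; no)
open import Relation.Nullary.Decidable using (¬?; decidable-stable; map′; _×-dec_)

-- Whether F[x]/(x^n - g) is a domain is the very question, so unequal elements of it cannot be
-- assumed to have a cancellable difference. Distinctness of u and v is therefore always stated as
-- "u z = v z implies z = 0", which is exactly what counting roots needs, and facts about orders
-- carry the same factor z.
--
-- The quotient is realised by operators on sequences with u(j + n) = g u(j), compared at one such
-- sequence; a coefficient of a polynomial in α is then read off from a single entry.
--
-- The q-power map is controlled without mentioning the characteristic: (c + X)^q - X^q - c has only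
-- q coefficients and vanishes at the q elements of F.
--
-- The condition on 4 comes from the factor (q^p - 1)/(q - 1), which should contribute exactly one
-- p. For p = 2 it is q + 1, divisible by 4 when q ≡ 3 mod 4.
--
-- Going from (1) to (2) needs a generator in each field, so cyclicity of the unit group is proved
-- as well.

-- Number theory: lifting the exponent

module NumberTheory where
  open import Data.Nat using (_+_; _*_; _^_; _≟_)
  open import Data.Nat.Properties

  prime-divisor : ∀ n .{{_ : NonZero n}} → n ≢ 1 → ∃ λ p → Prime p × p ∣ n
  prime-divisor n n≢1 with factorise n
  ... | record { factors = [] ; isFactorisation = n≡1 } = ⊥-elim (n≢1 n≡1)
  ... | record { factors = p ∷ ps ; isFactorisation = eq ; factorsPrime = pr ∷ _ } =
    p , pr , ≡.subst (p ∣_) (≡.sym eq) (m∣m*n _)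

  no-common-prime⇒coprime : ∀ {n m} .{{_ : NonZero n}} →
    (∀ p → Prime p → p ∣ n → ¬ p ∣ m) → Coprime n m
  no-common-prime⇒coprime {n} {m} h {d} (d∣n , d∣m) with d ≟ 1
  ... | yes d≡1 = d≡1
  ... | no d≢1 with prime-divisor d {{nonZero}} d≢1
    where nonZero = ≢-nonZero λ where ≡.refl → ≢-nonZero⁻¹ n (0∣⇒≡0 d∣n)
  ...   | p , pr , p∣d = ⊥-elim (h p pr (∣-trans p∣d d∣n) (∣-trans p∣d d∣m))

  prime∣prime⇒≡ : ∀ {p r} → Prime p → Prime r → p ∣ r → p ≡ r
  prime∣prime⇒≡ {p} pp pr p∣r with prime⇒irreducible pr p∣r
  ... | inj₁ p≡1 = ⊥-elim (n≮n 1 (≡.subst (1 <_) p≡1 (nonTrivial⇒n>1 p {{prime⇒nonTrivial pp}})))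
  ... | inj₂ p≡r = p≡r

  prime∤1 : ∀ {p} → Prime p → ¬ p ∣ 1
  prime∤1 {p} pp p∣1 = n≮n 1 (≡.subst (1 <_) (∣1⇒≡1 p∣1) (nonTrivial⇒n>1 p {{prime⇒nonTrivial pp}}))

  -- This is (q^l - 1)/(q - 1) = 1 + q + ... + q^(l - 1), free of division and subtraction.
  geom : ℕ → ℕ → ℕ
  geom q zero    = 0
  geom q (suc l) = 1 + q * geom q l

  geom-+ : ∀ q a b → geom q (a + b) ≡ geom q a + q ^ a * geom q b
  geom-+ q zero    b = ≡.sym (+-identityʳ _)
  geom-+ q (suc a) b rewrite geom-+ q a b = lem q (geom q a) (q ^ a) (geom q b)
    where lem : ∀ q x y z → 1 + q * (x + y * z) ≡ (1 + q * x) + (q * y) * z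
          lem = solve-∀

  -- The quotient (q^(ba) - 1)/(q - 1) passes through q^a - 1. With a = p this splits one prime off
  -- the exponent.
  geom-* : ∀ q a b → geom q (b * a) ≡ geom q a * geom (q ^ a) b
  geom-* q a zero    = ≡.sym (*-zeroʳ (geom q a))
  geom-* q a (suc b) rewrite geom-+ q a (b * a) | geom-* q a b =
    lem (geom q a) (q ^ a) (geom (q ^ a) b)
    where lem : ∀ x y z → x + y * (x * z) ≡ x * (1 + y * z)
          lem = solve-∀

  ^-geom : ∀ x l → suc x ^ l ≡ suc (x * geom (suc x) l)
  ^-geom x zero    = ≡.cong suc (≡.sym (*-zeroʳ x))
  ^-geom x (suc l) rewrite ^-geom x l = lem x (geom (suc x) l)
    where lem : ∀ x g → suc x * suc (x * g) ≡ suc (x * (1 + suc x * g))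
          lem = solve-∀

  -- The binomial coefficient m (m - 1)/2.
  triangle : ℕ → ℕ
  triangle zero    = 0
  triangle (suc m) = triangle m + m

  2*triangle : ∀ m → 2 * triangle (suc m) ≡ suc m * m
  2*triangle zero    = ≡.refl
  2*triangle (suc m) = ≡.trans (*-distribˡ-+ 2 (triangle (suc m)) (suc m))
    (≡.trans (≡.cong (_+ 2 * suc m) (2*triangle m)) (lem m))
    where lem : ∀ m → suc m * m + 2 * suc m ≡ suc (suc m) * suc m
          lem = solve-∀

  -- Binomial expansion of ((1 + x)^m - 1)/x up to terms in x².
  geom-expand : ∀ x m → ∃ λ w → geom (suc x) m ≡ m + x * triangle m + x * x * w
  geom-expand x zero    = 0 , lem x
    where lem : ∀ x → 0 ≡ 0 + x * 0 + x * x * 0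
          lem = solve-∀
  geom-expand x (suc m) with geom-expand x m
  ... | w , eq = w + triangle m + x * w ,
    ≡.trans (≡.cong (λ v → 1 + suc x * v) eq) (lem x m (triangle m) w)
    where lem : ∀ x m t w → 1 + suc x * (m + x * t + x * x * w)
                ≡ suc m + x * (t + m) + x * x * (w + t + x * w)
          lem = solve-∀

  -- Modulo x every summand of the geometric sum is 1, so the sum is congruent to m; `∣geom` uses
  -- the same congruence backwards.
  geom-mod : ∀ {r} x m → r ∣ x → r ∣ geom (suc x) m → r ∣ m
  geom-mod x m r∣x r∣g with geom-expand x m
  ... | w , eq = ∣m+n∣m⇒∣n {m = x * triangle m + x * x * w}
    (≡.subst (_ ∣_) (≡.trans eq (lem m (x * triangle m) (x * x * w))) r∣g)
    (∣m∣n⇒∣m+n (∣m⇒∣m*n _ r∣x) (∣m⇒∣m*n w (∣m⇒∣m*n x r∣x)))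
    where lem : ∀ a b c → a + b + c ≡ (b + c) + a
          lem = solve-∀

  ∣geom : ∀ {r} x m → r ∣ x → r ∣ m → r ∣ geom (suc x) m
  ∣geom x m r∣x r∣m with geom-expand x m
  ... | w , eq = ≡.subst (_ ∣_) (≡.sym eq)
    (∣m∣n⇒∣m+n (∣m∣n⇒∣m+n r∣m (∣m⇒∣m*n _ r∣x)) (∣m⇒∣m*n w (∣m⇒∣m*n x r∣x)))

  -- The last hypothesis only bites for p = 2: for odd p the prime divides p (p − 1) / 2.
  geom-prime : ∀ {p} x → Prime p → p ∣ x → (p ≡ 2 → 4 ∣ x) →
    ∃ λ c → geom (suc x) p ≡ p * c × ¬ p ∣ c
  geom-prime {p} .(k * p) pp (divides k ≡.refl) h with geom-expand (k * p) p
  ... | w , eq = 1 + k * triangle p + p * (k * k * w) ,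
    ≡.trans eq (lem p k (triangle p) w) ,
    λ p∣c → prime∤1 pp (∣m+n∣m⇒∣n {m = k * triangle p}
      (≡.subst (p ∣_) (+-comm 1 (k * triangle p)) (∣m+n∣m⇒∣n
        (≡.subst (p ∣_) (+-comm (1 + k * triangle p) (p * (k * k * w))) p∣c) (m∣m*n _)))
      p∣k*tri)
    where
    lem : ∀ p k t w → p + (k * p) * t + (k * p) * (k * p) * w ≡ p * (1 + k * t + p * (k * k * w))
    lem = solve-∀
    p∣2*tri : ∀ {p} → Prime p → p ∣ 2 * triangle p
    p∣2*tri {suc m} _ = ≡.subst (suc m ∣_) (≡.sym (2*triangle m)) (m∣m*n m)
    p∣k*tri : p ∣ k * triangle p
    p∣k*tri with euclidsLemma 2 (triangle p) pp (p∣2*tri pp)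
    ... | inj₂ p∣t = ∣n⇒∣m*n k p∣t
    -- Here p = 2 and `triangle 2` is 1, so the factor 2 must come from k, that is, from 4 ∣ x = 2k.
    ... | inj₁ p∣2 with prime∣prime⇒≡ pp prime[2] p∣2
    ...   | ≡.refl = ∣m⇒∣m*n {m = k} (triangle 2) (*-cancelʳ-∣ {2} {k} 2 (h ≡.refl))

  -- Condition (3) at one index, with x in the place of q - 1.
  Admissible : ℕ → ℕ → Set
  Admissible n x = (∀ p → Prime p → p ∣ n → p ∣ x) × (4 ∣ n → 4 ∣ x)

  -- Induction on n = n′ p. The prime p divides x, hence l = l′ p, and the geometric sum splits into
  -- `geom (suc x) p` and the sum of length l′ to the base (1 + x)^p = 1 + y. The first factor is p
  -- c with c prime to n′, so n′ divides the second; y is a multiple of x and stays admissible.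
  admissible∧∣geom⇒∣ : ∀ n x l .{{_ : NonZero n}} → Admissible n x → n ∣ geom (suc x) l → n ∣ l
  admissible∧∣geom⇒∣ n x l = go n x l (<-wellFounded n)
    where
    go : ∀ n x l → Acc _<_ n → .{{_ : NonZero n}} → Admissible n x → n ∣ geom (suc x) l → n ∣ l
    go n x l (acc rec) (h , h₄) n∣g with n ≟ 1
    ... | yes ≡.refl = 1∣ l
    ... | no n≢1 with prime-divisor n n≢1
    ...   | p , pp , divides n′ ≡.refl = step (geom-mod x l p∣x (∣-trans p∣n n∣g))
      where
      instance
        p≢0 = prime⇒nonZero pp
        n′≢0 = m*n≢0⇒m≢0 n′ {p}
      p∣n : p ∣ n′ * p
      p∣n = n∣m*n n′
      p∣x : p ∣ x
      p∣x = h p pp p∣n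
      n′<n : n′ < n′ * p
      n′<n = m<m*n n′ p (nonTrivial⇒n>1 p {{prime⇒nonTrivial pp}})
      step : p ∣ l → n′ * p ∣ l
      step (divides l′ ≡.refl) = *-monoˡ-∣ p n′∣l′
        where
        y = x * geom (suc x) p
        g≡ : geom (suc x) (l′ * p) ≡ geom (suc x) p * geom (suc y) l′
        g≡ = ≡.trans (geom-* (suc x) p l′) (≡.cong (λ v → geom (suc x) p * geom v l′) (^-geom x p))
        adm : Admissible n′ y
        adm = (λ r pr r∣ → ∣m⇒∣m*n _ (h r pr (∣m⇒∣m*n p r∣))) , λ 4∣ → ∣m⇒∣m*n _ (h₄ (∣m⇒∣m*n p 4∣))
        -- If p divides n′ as well, then p² ∣ n; for p = 2 this activates the condition on 4, as
        -- `geom-prime` requires. Otherwise c may contain p: a prime r dividing both n′ and c would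
        -- divide p, so r = p, against p ∤ n′.
        cofactor : ∃ λ c → geom (suc x) p ≡ p * c × Coprime n′ c
        cofactor with p ∣? n′
        ... | yes p∣n′ with geom-prime x pp p∣x (λ where ≡.refl → h₄ (*-monoˡ-∣ 2 p∣n′))
        ...   | c , eq , p∤c = c , eq , no-common-prime⇒coprime λ r pr r∣n′ r∣c → p∤c
            (≡.subst (_∣ c) (prime∣prime⇒≡ pr pp (geom-mod x p (h r pr (∣m⇒∣m*n p r∣n′))
              (≡.subst (r ∣_) (≡.sym eq) (∣n⇒∣m*n p r∣c)))) r∣c)
        cofactor | no p∤n′ with ∣geom x p p∣x ∣-refl
        ... | divides c eq = c , ≡.trans eq (*-comm c p) ,
          no-common-prime⇒coprime λ r pr r∣n′ r∣c → p∤n′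
            (≡.subst (_∣ n′) (prime∣prime⇒≡ pr pp (geom-mod x p (h r pr (∣m⇒∣m*n p r∣n′))
              (≡.subst (r ∣_) (≡.sym eq) (∣m⇒∣m*n p r∣c)))) r∣n′)
        n′∣l′ : n′ ∣ l′
        n′∣l′ with cofactor
        ... | c , eq , cop = go n′ y l′ (rec n′<n) adm (coprime-divisor cop
          (*-cancelʳ-∣ p (≡.subst (n′ * p ∣_) (≡.trans g≡ (≡.trans (≡.cong (_* geom (suc y) l′) eq)
            (lem p c (geom (suc y) l′)))) n∣g)))
          where lem : ∀ p c g → p * c * g ≡ c * g * p
                lem = solve-∀

open NumberTheory

-- Divisors of prime powers

prime∣^⇒∣ : ∀ {r p} k → Prime r → r ∣ p ℕ.^ k → r ∣ p
prime∣^⇒∣ zero    pr r∣1 = ⊥-elim (prime∤1 pr r∣1)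
prime∣^⇒∣ {p = p} (suc k) pr r∣ with euclidsLemma p (p ℕ.^ k) pr r∣
... | inj₁ r∣p  = r∣p
... | inj₂ r∣pᵏ = prime∣^⇒∣ k pr r∣pᵏ

^-coprime : ∀ {p c} k → Prime p → ¬ p ∣ c → Coprime (p ℕ.^ k) c
^-coprime {p} k pp p∤c = no-common-prime⇒coprime {{ℕ.m^n≢0 p k {{prime⇒nonZero pp}}}} λ r pr r∣ r∣c →
  p∤c (≡.subst (_∣ _) (prime∣prime⇒≡ pr pp (prime∣^⇒∣ k pr r∣)) r∣c)

∣p^⇒≡⊎∣ : ∀ {p d} a → Prime p → d ∣ p ℕ.^ suc a → d ≡ p ℕ.^ suc a ⊎ d ∣ p ℕ.^ a
∣p^⇒≡⊎∣ {p} {d} a pp (divides c eq) with p ∣? c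
... | yes (divides c′ ≡.refl) = inj₂ (divides c′ (ℕ.*-cancelˡ-≡ _ _ p {{prime⇒nonZero pp}}
  (≡.trans eq (≡.trans (≡.cong (ℕ._* d) (ℕ.*-comm c′ p)) (ℕ.*-assoc p c′ d)))))
... | no p∤c = inj₁ (≡.sym (≡.trans eq (≡.trans (≡.cong (ℕ._* d) c≡1) (ℕ.*-identityˡ d))))
  where c≡1 = ^-coprime (suc a) pp p∤c (divides d (≡.trans eq (ℕ.*-comm c d)) , ∣-refl)

prime-part : ∀ {p} d .{{_ : NonZero d}} → Prime p → p ∣ d →
  ∃ λ a → ∃ λ c → d ≡ p ℕ.^ suc a ℕ.* c × ¬ p ∣ c
prime-part {p} d pp = go d (<-wellFounded d)
  where
  go : ∀ d → Acc _<_ d → .{{_ : NonZero d}} → p ∣ d → ∃ λ a → ∃ λ c → d ≡ p ℕ.^ suc a ℕ.* c × ¬ p ∣ c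
  go _ (acc rec) (divides c ≡.refl) with p ∣? c
  ... | no p∤c = 0 , c , ≡.trans (ℕ.*-comm c p) (≡.cong (ℕ._* c) (≡.sym (ℕ.*-identityʳ p))) , p∤c
  ... | yes p∣c with go c (rec (ℕ.m<m*n c p (nonTrivial⇒n>1 p {{prime⇒nonTrivial pp}}))) p∣c
    where instance c≢0 = ℕ.m*n≢0⇒m≢0 c {p}
  ...   | a , c′ , eq , p∤c′ = suc a , c′ ,
    ≡.trans (≡.cong (ℕ._* p) eq) (≡.trans (ℕ.*-comm _ p) (≡.sym (ℕ.*-assoc p _ c′))) , p∤c′

prime∤⇒coprime : ∀ {p n} → Prime p → ¬ p ∣ n → Coprime p n
prime∤⇒coprime pp p∤n (d∣p , d∣n) with prime⇒irreducible pp d∣p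
... | inj₁ d≡1    = d≡1
... | inj₂ ≡.refl = ⊥-elim (p∤n d∣n)

-- Polynomials over a commutative ring as coefficient sequences

module Polynomials (K : CommutativeRing 0ℓ 0ℓ) where
  open CommutativeRing K hiding (zero)
  open import Algebra.Properties.CommutativeSemiring.Exp commutativeSemiring
  open import Algebra.Solver.Ring.NaturalCoefficients.Default commutativeSemiring
  open import Relation.Binary.Reasoning.Setoid setoid

  1^n≈1 : ∀ n → 1# ^ n ≈ 1#
  1^n≈1 zero    = refl
  1^n≈1 (suc n) = trans (*-identityˡ _) (1^n≈1 n)

  ^-fix-* : ∀ {x z} m k → x ^ m * z ≈ z → x ^ (k ℕ.* m) * z ≈ z
  ^-fix-* m zero    h = *-identityˡ _
  ^-fix-* {x} {z} m (suc k) h = begin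
    x ^ (m ℕ.+ k ℕ.* m) * z        ≈⟨ *-congʳ (^-homo-* x m (k ℕ.* m)) ⟩
    x ^ m * x ^ (k ℕ.* m) * z      ≈⟨ *-assoc _ _ _ ⟩
    x ^ m * (x ^ (k ℕ.* m) * z)    ≈⟨ *-congˡ (^-fix-* m k h) ⟩
    x ^ m * z                      ≈⟨ h ⟩
    z                              ∎

  -- A Bézout identity d + k a = l b lets x^d absorb a power that fixes z, so x need not be
  -- invertible. The factor z makes this usable in the presence of zero divisors.
  ^-fix-gcd : ∀ {x z} m n → x ^ m * z ≈ z → x ^ n * z ≈ z → x ^ gcd m n * z ≈ z
  ^-fix-gcd {x} {z} m n hm hn = go (Bézout.identity (gcd-GCD m n))
    where
    d = gcd m n
    bez : ∀ a b k l → x ^ a * z ≈ z → x ^ b * z ≈ z → d ℕ.+ k ℕ.* a ≡ l ℕ.* b → x ^ d * z ≈ z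
    bez a b k l ha hb eq = begin
      x ^ d * z                      ≈⟨ *-congˡ (^-fix-* a k ha) ⟨
      x ^ d * (x ^ (k ℕ.* a) * z)    ≈⟨ *-assoc _ _ _ ⟨
      x ^ d * x ^ (k ℕ.* a) * z      ≈⟨ *-congʳ (^-homo-* x d (k ℕ.* a)) ⟨
      x ^ (d ℕ.+ k ℕ.* a) * z        ≡⟨ ≡.cong (λ v → x ^ v * z) eq ⟩
      x ^ (l ℕ.* b) * z              ≈⟨ ^-fix-* b l hb ⟩
      z                              ∎
    go : Bézout.Identity d m n → x ^ d * z ≈ z
    go (Bézout.+- l k eq) = bez n m k l hn hm eq
    go (Bézout.-+ k l eq) = bez m n k l hm hn eq

  -- Horner evaluation; d counts coefficients, so the degree is below d.
  eval : ℕ → (ℕ → Carrier) → Carrier → Carrier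
  eval zero    f y = 0#
  eval (suc d) f y = f 0 + y * eval d (f ∘ suc) y

  eval-cong : ∀ d {f g y z} → (∀ i → i < d → f i ≈ g i) → y ≈ z → eval d f y ≈ eval d g z
  eval-cong zero    h y≈z = refl
  eval-cong (suc d) h y≈z =
    +-cong (h 0 (s≤s z≤n)) (*-cong y≈z (eval-cong d (λ i i<d → h (suc i) (s≤s i<d)) y≈z))

  eval-0 : ∀ d {f y} → (∀ i → i < d → f i ≈ 0#) → eval d f y ≈ 0#
  eval-0 zero    h = refl
  eval-0 (suc d) h = trans (+-cong (h 0 (s≤s z≤n))
    (trans (*-congˡ (eval-0 d (λ i i<d → h (suc i) (s≤s i<d)))) (zeroʳ _))) (+-identityʳ _)

  eval-linear : ∀ d f g c y → eval d (λ i → c * f i + g i) y ≈ c * eval d f y + eval d g y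
  eval-linear zero    f g c y = sym (trans (+-identityʳ _) (zeroʳ c))
  eval-linear (suc d) f g c y = trans (+-congˡ (*-congˡ (eval-linear d (f ∘ suc) (g ∘ suc) c y)))
    (solve 6 (λ f₀ g₀ c y p q → c :* f₀ :+ g₀ :+ y :* (c :* p :+ q) :=
                c :* (f₀ :+ y :* p) :+ (g₀ :+ y :* q)) refl (f 0) (g 0) c y _ _)

  eval-*ʳ : ∀ d f b y → eval d (λ i → f i * b) y ≈ eval d f y * b
  eval-*ʳ zero    f b y = sym (zeroˡ b)
  eval-*ʳ (suc d) f b y = trans (+-congˡ (*-congˡ (eval-*ʳ d (f ∘ suc) b y)))
    (solve 4 (λ f₀ b y p → f₀ :* b :+ y :* (p :* b) := (f₀ :+ y :* p) :* b) refl (f 0) b y _)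

  eval-last : ∀ d f y → eval (suc d) f y ≈ eval d f y + f d * y ^ d
  eval-last zero    f y =
    solve 2 (λ f₀ y → f₀ :+ y :* con 0 := con 0 :+ f₀ :* con 1) refl (f 0) y
  eval-last (suc d) f y = trans (+-congˡ (*-congˡ (eval-last d (f ∘ suc) y)))
    (solve 5 (λ f₀ y p c t → f₀ :+ y :* (p :+ c :* t) := f₀ :+ y :* p :+ c :* (y :* t))
      refl (f 0) y _ _ _)

  eval-extend : ∀ k r f y → (∀ j → r ≤ j → f j ≈ 0#) → eval (k ℕ.+ r) f y ≈ eval r f y
  eval-extend zero    r f y h = refl
  eval-extend (suc k) r f y h = trans (eval-last (k ℕ.+ r) f y)
    (trans (+-cong (eval-extend k r f y h) (trans (*-congʳ (h _ (ℕ.m≤n+m r k))) (zeroˡ _)))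
      (+-identityʳ _))

  -- Synthetic division: the coefficients of (f(y) - f(y₀))/(y - y₀), one fewer than those of f.
  quot : ℕ → (ℕ → Carrier) → Carrier → ℕ → Carrier
  quot zero    f y₀ _       = 0#
  quot (suc d) f y₀ zero    = eval d (f ∘ suc) y₀
  quot (suc d) f y₀ (suc i) = quot d (f ∘ suc) y₀ i

  -- f(y) − f(y₀) = (y − y₀) h(y), rearranged so that no subtraction occurs.
  quot-eval : ∀ d f y y₀ → let h = eval d (quot (suc d) f y₀) y in
    eval (suc d) f y + y₀ * h ≈ eval (suc d) f y₀ + y * h
  quot-eval zero    f y y₀ = solve 3 (λ f₀ y y₀ →
    f₀ :+ y :* con 0 :+ y₀ :* con 0 := f₀ :+ y₀ :* con 0 :+ y :* con 0) refl (f 0) y y₀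
  quot-eval (suc d) f y y₀ = begin
    f 0 + y * p + y₀ * (p₀ + y * h)   ≈⟨ solve 6 (λ f₀ y y₀ p p₀ h →
      f₀ :+ y :* p :+ y₀ :* (p₀ :+ y :* h) := f₀ :+ y₀ :* p₀ :+ y :* (p :+ y₀ :* h))
      refl (f 0) y y₀ p p₀ h ⟩
    f 0 + y₀ * p₀ + y * (p + y₀ * h)  ≈⟨ +-congˡ (*-congˡ (quot-eval d (f ∘ suc) y y₀)) ⟩
    f 0 + y₀ * p₀ + y * (p₀ + y * h)  ∎
    where
    p  = eval (suc d) (f ∘ suc) y
    p₀ = eval (suc d) (f ∘ suc) y₀
    h  = eval d (quot (suc d) (f ∘ suc) y₀) y

  head≈0 : ∀ d f {y} → eval (suc d) f y ≈ 0# → (∀ i → i < d → f (suc i) ≈ 0#) → f 0 ≈ 0#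
  head≈0 d f {y} e h = begin
    f 0                               ≈⟨ +-identityʳ _ ⟨
    f 0 + 0#                          ≈⟨ +-congˡ (trans (*-congˡ (eval-0 d h)) (zeroʳ y)) ⟨
    f 0 + y * eval d (f ∘ suc) y      ≈⟨ e ⟩
    0#                                ∎

  -- Each coefficient of the quotient is f (i + 1) plus y₀ times the next one, so the coefficients
  -- of f vanish from the top down.
  quot≈0 : ∀ d f {y₀} → (∀ i → i < d → quot (suc d) f y₀ i ≈ 0#) → ∀ i → i < d → f (suc i) ≈ 0#
  quot≈0 (suc d) f h = λ where
      zero    _           → head≈0 d (f ∘ suc) (h 0 (s≤s z≤n)) tail
      (suc i) (s≤s i<d)   → tail i i<d
    where tail = quot≈0 d (f ∘ suc) (λ i i<d → h (suc i) (s≤s i<d))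

  -- Dividing by y - y₀ leaves a quotient vanishing at the other roots, provided that y - y₀ is
  -- regular there. Regularity of differences replaces inequality because the ring need not be a
  -- domain.
  distinct-roots : ∀ d f (y : Fin d → Carrier) →
    (∀ {i j} → i Fin.< j → ∀ z → y j * z ≈ y i * z → z ≈ 0#) →
    (∀ i → eval d f (y i) ≈ 0#) → ∀ i → i < d → f i ≈ 0#
  distinct-roots (suc d) f y dist root = λ where
      zero    _         → head≈0 d f (root zero) tail
      (suc i) (s≤s i<d) → tail i i<d
    where
    h = quot (suc d) f (y zero)
    h-root : ∀ i → eval d h (y (suc i)) ≈ 0#
    h-root i = dist (s≤s z≤n) _ (begin
      y (suc i) * H                                   ≈⟨ +-identityˡ _ ⟨
      0# + y (suc i) * H                              ≈⟨ +-congʳ (root zero) ⟨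
      eval (suc d) f (y zero) + y (suc i) * H         ≈⟨ quot-eval d f (y (suc i)) (y zero) ⟨
      eval (suc d) f (y (suc i)) + y zero * H         ≈⟨ +-congʳ (root (suc i)) ⟩
      0# + y zero * H                                 ≈⟨ +-identityˡ _ ⟩
      y zero * H                                      ∎)
      where H = eval d h (y (suc i))
    tail : ∀ i → i < d → f (suc i) ≈ 0#
    tail = quot≈0 d f (distinct-roots d h (y ∘ suc) (λ i<j → dist (s≤s i<j)) h-root)

  eval-binomial : ∀ m {C c d y} → C 0 ≈ c → C (suc m) ≈ d → (∀ i → i < m → C (suc i) ≈ 0#) →
    eval (suc (suc m)) C y ≈ c + d * y ^ suc m
  eval-binomial m {C} {c} {d} {y} h₀ hₘ h = trans (eval-last (suc m) C y)
    (+-cong (trans (+-cong h₀ (trans (*-congˡ (eval-0 m h)) (zeroʳ y))) (+-identityʳ c)) (*-congʳ hₘ))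

  sumTo : ℕ → (ℕ → Carrier) → Carrier
  sumTo zero    f = f zero
  sumTo (suc m) f = sumTo m f + f (suc m)

  conv : (ℕ → Carrier) → (ℕ → Carrier) → ℕ → Carrier
  conv A B i = sumTo i (λ j → A j * B (i ∸ j))

  sumTo-cong : ∀ m {f g} → (∀ j → j ≤ m → f j ≈ g j) → sumTo m f ≈ sumTo m g
  sumTo-cong zero    h = h 0 z≤n
  sumTo-cong (suc m) h =
    +-cong (sumTo-cong m (λ j j≤m → h j (ℕ.m≤n⇒m≤1+n j≤m))) (h (suc m) ℕ.≤-refl)

  sumTo-0 : ∀ m {f} → (∀ j → j ≤ m → f j ≈ 0#) → sumTo m f ≈ 0#
  sumTo-0 zero    h = h 0 z≤n
  sumTo-0 (suc m) h = trans
    (+-cong (sumTo-0 m (λ j j≤m → h j (ℕ.m≤n⇒m≤1+n j≤m))) (h (suc m) ℕ.≤-refl)) (+-identityʳ _)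

  sumTo-first : ∀ m f → sumTo (suc m) f ≈ f 0 + sumTo m (f ∘ suc)
  sumTo-first zero    f = refl
  sumTo-first (suc m) f = trans (+-congʳ (sumTo-first m f)) (+-assoc _ _ _)

  sumTo-linear : ∀ m c f g → sumTo m (λ j → c * f j + g j) ≈ c * sumTo m f + sumTo m g
  sumTo-linear zero    c f g = refl
  sumTo-linear (suc m) c f g = trans (+-congʳ (sumTo-linear m c f g))
    (solve 5 (λ c p q a b → c :* p :+ q :+ (c :* a :+ b) := c :* (p :+ a) :+ (q :+ b)) refl c _ _ _ _)

  conv-suc : ∀ A B i → conv A B (suc i) ≈ A 0 * B (suc i) + conv (A ∘ suc) B i
  conv-suc A B i = sumTo-first i _

  conv-cong : ∀ {A A′ B B′} i → (∀ j → j ≤ i → A j ≈ A′ j) → (∀ j → j ≤ i → B j ≈ B′ j) →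
    conv A B i ≈ conv A′ B′ i
  conv-cong i hA hB = sumTo-cong i (λ j j≤i → *-cong (hA j j≤i) (hB (i ∸ j) (ℕ.m∸n≤m i j)))

  conv-linearˡ : ∀ c A A′ B i → conv (λ j → c * A j + A′ j) B i ≈ c * conv A B i + conv A′ B i
  conv-linearˡ c A A′ B i = trans (sumTo-cong i (λ j _ →
    solve 4 (λ c a a′ b → (c :* a :+ a′) :* b := c :* (a :* b) :+ a′ :* b) refl c _ _ _))
    (sumTo-linear i c _ _)

  eval-conv : ∀ s r A B y → (∀ j → s ≤ j → A j ≈ 0#) → (∀ j → r ≤ j → B j ≈ 0#) →
    eval (s ℕ.+ r) (conv A B) y ≈ eval s A y * eval r B y
  eval-conv zero    r A B y hA hB = trans
    (eval-0 r (λ i _ → sumTo-0 i (λ j _ → trans (*-congʳ (hA j z≤n)) (zeroˡ _)))) (sym (zeroˡ _))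
  eval-conv (suc s) r A B y hA hB = begin
    A 0 * B 0 + y * eval (s ℕ.+ r) (conv A B ∘ suc) y
      ≈⟨ +-congˡ (*-congˡ (eval-cong (s ℕ.+ r) (λ i _ → conv-suc A B i) refl)) ⟩
    A 0 * B 0 + y * eval (s ℕ.+ r) (λ i → A 0 * B (suc i) + conv (A ∘ suc) B i) y
      ≈⟨ +-congˡ (*-congˡ (eval-linear (s ℕ.+ r) _ _ (A 0) y)) ⟩
    A 0 * B 0 + y * (A 0 * E + eval (s ℕ.+ r) (conv (A ∘ suc) B) y)
      ≈⟨ +-congˡ (*-congˡ (+-congˡ (eval-conv s r (A ∘ suc) B y (λ j s≤j → hA (suc j) (s≤s s≤j)) hB))) ⟩
    A 0 * B 0 + y * (A 0 * E + P * Q)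
      ≈⟨ solve 6 (λ a b y e p q → a :* b :+ y :* (a :* e :+ p :* q) := a :* (b :+ y :* e) :+ y :* p :* q)
           refl (A 0) (B 0) y E P Q ⟩
    A 0 * eval (suc s ℕ.+ r) B y + y * P * Q
      ≈⟨ +-congʳ (*-congˡ (eval-extend (suc s) r B y hB)) ⟩
    A 0 * Q + y * P * Q
      ≈⟨ distribʳ Q (A 0) (y * P) ⟨
    (A 0 + y * P) * Q ∎
    where
    E = eval (s ℕ.+ r) (B ∘ suc) y
    P = eval s (A ∘ suc) y
    Q = eval r B y

  conv-degree : ∀ s r A B i → s ℕ.+ r ≤ suc i →
    (∀ j → s ≤ j → A j ≈ 0#) → (∀ j → r ≤ j → B j ≈ 0#) → conv A B i ≈ 0#
  conv-degree s r A B i s+r≤ hA hB = sumTo-0 i term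
    where
    term : ∀ j → j ≤ i → A j * B (i ∸ j) ≈ 0#
    term j j≤i with s ℕ.≤? j
    ... | yes s≤j = trans (*-congʳ (hA j s≤j)) (zeroˡ _)
    ... | no s≰j  = trans (*-congˡ (hB (i ∸ j) r≤)) (zeroʳ _)
      where
      r≤ : r ≤ i ∸ j
      r≤ = ℕ.+-cancelˡ-≤ (suc j) r (i ∸ j) (ℕ.≤-trans (ℕ.+-monoˡ-≤ r (ℕ.≰⇒> s≰j))
        (≡.subst (s ℕ.+ r ≤_) (≡.cong suc (≡.sym (ℕ.m+[n∸m]≡n j≤i))) s+r≤))

-- Cancellation and multiplicative orders in a field

module FieldProperties (F : Field) where
  open Field F hiding (zero) public
  open import Algebra.Properties.CommutativeSemiring.Exp commutativeSemiring public
  open import Algebra.Properties.Ring ring public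
    using (+-cancelˡ; +-cancelʳ; -‿distribˡ-*; -‿distribʳ-*; -‿involutive; -‿+-comm; [y-z]x≈yx-zx; x∙y⁻¹≈ε⇒x≈y)
  open Polynomials commRing public
  open import Relation.Binary.Reasoning.Setoid setoid

  *-cancel-0 : ∀ {x y} → ¬ x ≈ 0# → x * y ≈ 0# → y ≈ 0#
  *-cancel-0 {x} {y} x≉0 xy≈0 with inverse x x≉0
  ... | x⁻¹ , xx⁻¹≈1 = begin
    y              ≈⟨ *-identityˡ y ⟨
    1# * y         ≈⟨ *-congʳ (trans (*-comm x⁻¹ x) xx⁻¹≈1) ⟨
    x⁻¹ * x * y    ≈⟨ *-assoc _ _ _ ⟩
    x⁻¹ * (x * y)  ≈⟨ *-congˡ xy≈0 ⟩
    x⁻¹ * 0#       ≈⟨ zeroʳ x⁻¹ ⟩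
    0#             ∎

  -- In a field, inequality already gives the regularity that `distinct-roots` asks for.
  distinct-cancel : ∀ {x y z} → ¬ x ≈ y → x * z ≈ y * z → z ≈ 0#
  distinct-cancel {x} {y} {z} x≉y h = *-cancel-0 (λ e → x≉y (x∙y⁻¹≈ε⇒x≈y x y e))
    (trans ([y-z]x≈yx-zx z x y) (trans (+-congʳ h) (-‿inverseʳ _)))

  *-cancel : ∀ {x y z} → ¬ z ≈ 0# → x * z ≈ y * z → x ≈ y
  *-cancel {x} {y} {z} z≉0 h = x∙y⁻¹≈ε⇒x≈y x y (*-cancel-0 z≉0 (trans (*-comm _ _)
    (trans ([y-z]x≈yx-zx z x y) (trans (+-congʳ h) (-‿inverseʳ _)))))

  *-nonzero : ∀ {x y} → ¬ x ≈ 0# → ¬ y ≈ 0# → ¬ x * y ≈ 0#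
  *-nonzero x≉0 y≉0 xy≈0 = y≉0 (*-cancel-0 x≉0 xy≈0)

  ^-nonzero : ∀ {x} n → ¬ x ≈ 0# → ¬ x ^ n ≈ 0#
  ^-nonzero zero    x≉0 = λ e → 0≉1 (sym e)
  ^-nonzero (suc n) x≉0 = *-nonzero x≉0 (^-nonzero n x≉0)

  ^≈1⇒nonzero : ∀ {x} n .{{_ : NonZero n}} → x ^ n ≈ 1# → ¬ x ≈ 0#
  ^≈1⇒nonzero (suc n) h x≈0 = 0≉1 (trans (sym (zeroˡ _)) (trans (*-congʳ (sym x≈0)) h))

  pow≡^ : ∀ x i → pow F x i ≡ x ^ i
  pow≡^ x zero    = ≡.refl
  pow≡^ x (suc i) = ≡.cong (x *_) (pow≡^ x i)

  fix : ∀ {x} → x ≈ 1# → x * 1# ≈ 1#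
  fix h = trans (*-identityʳ _) h

  unfix : ∀ {x} → x * 1# ≈ 1# → x ≈ 1#
  unfix h = trans (sym (*-identityʳ _)) h

  ^∣≈1 : ∀ x m {n} → x ^ m ≈ 1# → m ∣ n → x ^ n ≈ 1#
  ^∣≈1 x m h (divides k ≡.refl) = unfix (^-fix-* m k (fix h))

  ^-cancel : ∀ {x} m n → ¬ x ≈ 0# → x ^ (m ℕ.+ n) ≈ x ^ m → x ^ n ≈ 1#
  ^-cancel {x} m n x≉0 h = *-cancel (^-nonzero m x≉0)
    (trans (*-comm _ _) (trans (sym (^-homo-* x m n)) (trans h (sym (*-identityˡ _)))))

  HasOrder : Carrier → ℕ → Set
  HasOrder x d = x ^ d ≈ 1# × (∀ i → x ^ i ≈ 1# → d ∣ i)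

  -- Raising (x y)^i = 1 to the power n removes y and leaves m ∣ i n, so m ∣ i by coprimality;
  -- symmetrically n ∣ i.
  order-* : ∀ {x y m n} → Coprime m n → HasOrder x m → HasOrder y n → HasOrder (x * y) (m ℕ.* n)
  order-* {x} {y} {m} {n} cop (xᵐ≈1 , ox) (yⁿ≈1 , oy) =
    trans (^-distrib-* x y (m ℕ.* n)) (trans (*-cong (^∣≈1 x m xᵐ≈1 (m∣m*n n)) (^∣≈1 y n yⁿ≈1 (n∣m*n m)))
      (*-identityˡ 1#)) ,
    λ i h → combine i
      (coprime-divisor cop (≡.subst (m ∣_) (ℕ.*-comm i n) (ox (i ℕ.* n) (project i n h yⁿ≈1))))
      (coprime-divisor (Coprime.sym cop) (≡.subst (n ∣_) (ℕ.*-comm i m)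
        (oy (i ℕ.* m) (project i m (trans (^-congˡ i (*-comm y x)) h) xᵐ≈1))))
    where
    project : ∀ {x y} i n → (x * y) ^ i ≈ 1# → y ^ n ≈ 1# → x ^ (i ℕ.* n) ≈ 1#
    project {x} {y} i n h yⁿ≈1 = begin
      x ^ (i ℕ.* n)                    ≈⟨ *-identityʳ _ ⟨
      x ^ (i ℕ.* n) * 1#               ≈⟨ *-congˡ (^∣≈1 y n yⁿ≈1 (n∣m*n i)) ⟨
      x ^ (i ℕ.* n) * y ^ (i ℕ.* n)    ≈⟨ ^-distrib-* x y (i ℕ.* n) ⟨
      (x * y) ^ (i ℕ.* n)              ≈⟨ ^∣≈1 (x * y) i h (m∣m*n n) ⟩
      1#                               ∎
    combine : ∀ i → m ∣ i → n ∣ i → m ℕ.* n ∣ i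
    combine _ (divides k ≡.refl) n∣i with coprime-divisor (Coprime.sym cop)
      (≡.subst (n ∣_) (ℕ.*-comm k m) n∣i)
    ... | n∣k = ≡.subst (m ℕ.* n ∣_) (ℕ.*-comm m k) (*-monoʳ-∣ m n∣k)

  -- The gcd of i and p^(a + 1) is again an exponent giving 1. Unless it is all of p^(a + 1) it
  -- divides p^a, which is excluded.
  order-^ : ∀ {x p} a → Prime p → x ^ (p ℕ.^ suc a) ≈ 1# → ¬ x ^ (p ℕ.^ a) ≈ 1# → HasOrder x (p ℕ.^ suc a)
  order-^ {x} {p} a pp h h′ = h , λ i xⁱ≈1 → go i xⁱ≈1
    (∣p^⇒≡⊎∣ a pp (gcd[m,n]∣n i (p ℕ.^ suc a)))
    where
    go : ∀ i → x ^ i ≈ 1# → gcd i (p ℕ.^ suc a) ≡ p ℕ.^ suc a ⊎ gcd i (p ℕ.^ suc a) ∣ p ℕ.^ a →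
      p ℕ.^ suc a ∣ i
    go i xⁱ≈1 (inj₁ eq) = ≡.subst (_∣ i) eq (gcd[m,n]∣m i _)
    go i xⁱ≈1 (inj₂ d∣) = ⊥-elim (h′ (^∣≈1 x _ (unfix (^-fix-gcd i _ (fix xⁱ≈1) (fix h))) d∣))

-- Finite fields with q = e + 1 elements and cyclicity of their unit groups

module FiniteField (F : Field) {e : ℕ} (size : HasSize F (suc e)) where
  open FieldProperties F public
  open import Relation.Binary.Reasoning.Setoid setoid
  open import Algebra.Properties.CommutativeMonoid.Sum *-commutativeMonoid
    using (sum-permute; ∑-distrib-+) renaming (sum to prod)
  open import Algebra.Properties.Monoid.Sum *-monoid using (sum-replicate; sum-cong-≋)

  elem : Fin (suc e) → Carrier
  elem = proj₁ size

  index : Carrier → Fin (suc e)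
  index x = proj₁ (proj₂ (proj₂ size) x)

  elem-index : ∀ x → elem (index x) ≈ x
  elem-index x = proj₂ (proj₂ (proj₂ size) x)

  elem-injective : ∀ i j → elem i ≈ elem j → i ≡ j
  elem-injective = proj₁ (proj₂ size)

  infix 4 _≈?_
  _≈?_ : ∀ x y → Dec (x ≈ y)
  x ≈? y = map′
    (λ eq → trans (sym (elem-index x)) (trans (reflexive (≡.cong elem eq)) (elem-index y)))
    (λ h → elem-injective _ _ (trans (elem-index x) (trans h (sym (elem-index y)))))
    (index x Fin.≟ index y)

  unit : Fin e → Carrier
  unit i = elem (punchIn (index 0#) i)

  unit-nonzero : ∀ i → ¬ unit i ≈ 0#
  unit-nonzero i h = Fin.punchInᵢ≢i (index 0#) i (elem-injective _ _ (trans h (sym (elem-index 0#))))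

  unit-injective : ∀ i j → unit i ≈ unit j → i ≡ j
  unit-injective i j h = Fin.punchIn-injective (index 0#) i j (elem-injective _ _ h)

  module _ {x} (x≉0 : ¬ x ≈ 0#) where
    0≢index : index 0# ≢ index x
    0≢index eq = x≉0 (trans (sym (elem-index x)) (trans (reflexive (≡.cong elem (≡.sym eq))) (elem-index 0#)))

    unitIndex : Fin e
    unitIndex = punchOut 0≢index

    unit-unitIndex : unit unitIndex ≈ x
    unit-unitIndex = trans (reflexive (≡.cong elem (Fin.punchIn-punchOut 0≢index))) (elem-index x)

  e≢0 : NonZero e
  e≢0 = ≢-nonZero λ where ≡.refl → Fin.¬Fin0 (unitIndex {1#} (λ h → 0≉1 (sym h)))

  prod-nonzero : ∀ {n} (f : Fin n → Carrier) → (∀ i → ¬ f i ≈ 0#) → ¬ prod f ≈ 0#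
  prod-nonzero {zero}  f h = λ e → 0≉1 (sym e)
  prod-nonzero {suc n} f h = *-nonzero (h zero) (prod-nonzero (f ∘ suc) (h ∘ suc))

  -- Multiplication by x permutes the units, so x ^ e times their product is their product.
  fermat : ∀ {x} → ¬ x ≈ 0# → x ^ e ≈ 1#
  fermat {x} x≉0 with inverse x x≉0
  ... | y , xy≈1 = *-cancel (prod-nonzero unit unit-nonzero) (begin
    x ^ e * prod unit             ≈⟨ *-congʳ (sum-replicate e {x}) ⟨
    prod {e} (λ _ → x) * prod unit    ≈⟨ ∑-distrib-+ {e} (λ _ → x) unit ⟨
    prod (λ i → x * unit i)       ≈⟨ sum-cong-≋ (λ i → unit-unitIndex (*-nonzero x≉0 (unit-nonzero i))) ⟨
    prod (λ i → unit (mul x≉0 i)) ≈⟨ sum-permute unit (permutation (mul x≉0) (mul y≉0)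
                                       (inv x≉0 y≉0 xy≈1) (inv y≉0 x≉0 (trans (*-comm y x) xy≈1))) ⟨
    prod unit                     ≈⟨ *-identityˡ _ ⟨
    1# * prod unit                ∎)
    where
    y≉0 : ¬ y ≈ 0#
    y≉0 h = 0≉1 (trans (sym (zeroʳ x)) (trans (*-congˡ (sym h)) xy≈1))
    mul : ∀ {x} → ¬ x ≈ 0# → Fin e → Fin e
    mul x≉0 i = unitIndex (*-nonzero x≉0 (unit-nonzero i))
    inv : ∀ {x y} (x≉0 : ¬ x ≈ 0#) (y≉0 : ¬ y ≈ 0#) → x * y ≈ 1# → ∀ i → mul x≉0 (mul y≉0 i) ≡ i
    inv {x} {y} x≉0 y≉0 h i = unit-injective _ _ (begin
      unit (mul x≉0 (mul y≉0 i))  ≈⟨ unit-unitIndex (*-nonzero x≉0 (unit-nonzero (mul y≉0 i))) ⟩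
      x * unit (mul y≉0 i)        ≈⟨ *-congˡ (unit-unitIndex (*-nonzero y≉0 (unit-nonzero i))) ⟩
      x * (y * unit i)            ≈⟨ *-assoc _ _ _ ⟨
      x * y * unit i              ≈⟨ *-congʳ h ⟩
      1# * unit i                 ≈⟨ *-identityˡ _ ⟩
      unit i                      ∎)

  ^q≈id : ∀ x → x ^ suc e ≈ x
  ^q≈id x with x ≈? 0#
  ... | yes x≈0 = trans (*-congʳ x≈0) (trans (zeroˡ _) (sym x≈0))
  ... | no x≉0  = trans (*-congˡ (fermat x≉0)) (*-identityʳ x)

  -- If g^m = 1, the logarithms of all units can be reduced below m, which injects `Fin e` into
  -- `Fin m`.
  generator-order : ∀ {g} → IsGenerator F g → ∀ m .{{_ : NonZero m}} → g ^ m ≈ 1# → e ≤ m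
  generator-order {g} (g≉0 , gen) m gᵐ≈1 = Fin.injective⇒≤ {f = f} λ {i} {j} eq →
    unit-injective i j (trans (sym (f-log i)) (trans (reflexive (≡.cong (λ k → g ^ toℕ k) eq)) (f-log j)))
    where
    log : Fin e → ℕ
    log i = proj₁ (gen (unit i) (unit-nonzero i))
    f : Fin e → Fin m
    f i = fromℕ< (ℕ.m%n<n (log i) m)
    f-log : ∀ i → g ^ toℕ (f i) ≈ unit i
    f-log i = begin
      g ^ toℕ (f i)                         ≡⟨ ≡.cong (g ^_) (Fin.toℕ-fromℕ< (ℕ.m%n<n (log i) m)) ⟩
      g ^ (log i % m)                       ≈⟨ *-identityʳ _ ⟨
      g ^ (log i % m) * 1#                  ≈⟨ *-congˡ (^∣≈1 g m gᵐ≈1 (n∣m*n (log i ℕ./ m))) ⟨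
      g ^ (log i % m) * g ^ (log i ℕ./ m ℕ.* m)   ≈⟨ ^-homo-* g (log i % m) _ ⟨
      g ^ (log i % m ℕ.+ log i ℕ./ m ℕ.* m) ≡⟨ ≡.cong (g ^_) (ℕ.m≡m%n+[m/n]*n (log i) m) ⟨
      g ^ log i                             ≡⟨ pow≡^ g (log i) ⟨
      pow F g (log i)                       ≈⟨ proj₂ (gen (unit i) (unit-nonzero i)) ⟩
      unit i                                ∎

  -- X^m - 1 has at most m roots, fewer than there are units.
  nonroot : ∀ m .{{_ : NonZero m}} → m < e → ∃ λ x → ¬ x ≈ 0# × ¬ x ^ m ≈ 1#
  nonroot (suc m) m<e with Fin.any? (λ i → ¬? (unit i ^ suc m ≈? 1#))
  ... | yes (i , h) = unit i , unit-nonzero i , h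
  -- With exponent suc m the bound reads suc (suc m) ≤ e: as many units as X^(m + 1) - 1 has
  -- coefficients, so all of these would vanish, the leading 1 included.
  ... | no none = ⊥-elim (0≉1 (sym (trans (sym C-top)
          (distinct-roots (suc (suc m)) C (λ i → unit (inject≤ i m<e))
            (λ {i} {j} i<j z → distinct-cancel λ h →
              Fin.<⇒≢ i<j (≡.sym (Fin.inject≤-injective m<e m<e j i (unit-injective _ _ h))))
            (λ i → trans (eval-binomial m {C} refl C-top C-mid)
              (trans (+-congˡ (trans (*-identityˡ _) (all-roots (inject≤ i m<e)))) (-‿inverseˡ 1#)))
            (suc m) ℕ.≤-refl))))
    where
    C : ℕ → Carrier
    C zero = - 1#
    C (suc i) with i ℕ.≟ m
    ... | yes _ = 1#
    ... | no _  = 0#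
    C-top : C (suc m) ≈ 1#
    C-top with m ℕ.≟ m
    ... | yes _  = refl
    ... | no m≢m = ⊥-elim (m≢m ≡.refl)
    C-mid : ∀ i → i < m → C (suc i) ≈ 0#
    C-mid i i<m with i ℕ.≟ m
    ... | yes i≡m = ⊥-elim (ℕ.<⇒≢ i<m i≡m)
    ... | no _    = refl
    all-roots : ∀ i → unit i ^ suc m ≈ 1#
    all-roots i = decidable-stable (unit i ^ suc m ≈? 1#) λ h → none (i , h)

  -- An element x with x^(e/p) ≠ 1 is raised to the power c = e/p^(a + 1); the result still has a
  -- nontrivial p^a-th power.
  element-of-prime-power-order : ∀ {p} a → Prime p → p ℕ.^ suc a ∣ e → ∃ λ x → HasOrder x (p ℕ.^ suc a)
  element-of-prime-power-order {p} a pp (divides c e≡) with nonroot (c ℕ.* p ℕ.^ a) {{m≢0}} m<e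
    where
    ce≢0 : NonZero (c ℕ.* p ℕ.^ suc a)
    ce≢0 = ≡.subst NonZero e≡ e≢0
    c≢0 : NonZero c
    c≢0 = ℕ.m*n≢0⇒m≢0 c {{ce≢0}}
    m≢0 : NonZero (c ℕ.* p ℕ.^ a)
    m≢0 = ℕ.m*n≢0 c _ {{c≢0}} {{ℕ.m^n≢0 p a {{prime⇒nonZero pp}}}}
    m<e : c ℕ.* p ℕ.^ a < e
    m<e = ≡.subst (c ℕ.* p ℕ.^ a <_)
      (≡.trans (ℕ.*-assoc c (p ℕ.^ a) p) (≡.trans (≡.cong (c ℕ.*_) (ℕ.*-comm (p ℕ.^ a) p)) (≡.sym e≡)))
      (ℕ.m<m*n _ p {{m≢0}} (nonTrivial⇒n>1 p {{prime⇒nonTrivial pp}}))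
  ... | x , x≉0 , h = x ^ c , order-^ a pp
    (trans (^-assocʳ x c _) (trans (reflexive (≡.cong (x ^_) (≡.sym e≡))) (fermat x≉0)))
    (λ h′ → h (trans (sym (^-assocʳ x c _)) h′))

  -- The full p-part of d is split off, and elements of the two coprime orders are multiplied.
  element-of-order : ∀ d → d ∣ e → ∃ λ x → HasOrder x d
  element-of-order d = go d (<-wellFounded d)
    where
    go : ∀ d → Acc _<_ d → d ∣ e → ∃ λ x → HasOrder x d
    go d (acc rec) d∣e with d ℕ.≟ 1
    ... | yes ≡.refl = 1# , *-identityʳ 1# , λ i _ → 1∣ i
    ... | no d≢1 = extend (proj₁ part) (proj₁ (proj₂ part))
        (proj₁ (proj₂ (proj₂ part))) (proj₂ (proj₂ (proj₂ part)))
      where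
      instance
        d≢0 : NonZero d
        d≢0 = ≢-nonZero λ d≡0 → ℕ.≢-nonZero⁻¹ e {{e≢0}} (0∣⇒≡0 (≡.subst (_∣ e) d≡0 d∣e))
      p = proj₁ (prime-divisor d d≢1)
      pp = proj₁ (proj₂ (prime-divisor d d≢1))
      part = prime-part d pp (proj₂ (proj₂ (prime-divisor d d≢1)))
      extend : ∀ a c → d ≡ p ℕ.^ suc a ℕ.* c → ¬ p ∣ c → ∃ λ x → HasOrder x d
      extend a c d≡ p∤c = proj₁ x * proj₁ y , ≡.subst (HasOrder _) (≡.sym d≡)
        (order-* (^-coprime (suc a) pp p∤c) (proj₂ x) (proj₂ y))
        where
        c≢0 : NonZero c
        c≢0 = ≢-nonZero λ c≡0 → p∤c (≡.subst (p ∣_) (≡.sym c≡0) (p ∣0))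
        c<d : c < d
        c<d = ≡.subst (c <_) (≡.trans (ℕ.*-comm c _) (≡.sym d≡)) (ℕ.m<m*n c _ {{c≢0}}
          (ℕ.<-≤-trans (nonTrivial⇒n>1 p {{prime⇒nonTrivial pp}})
            (ℕ.m≤m*n p (p ℕ.^ a) {{ℕ.m^n≢0 p a {{prime⇒nonZero pp}}}})))
        x = element-of-prime-power-order a pp (∣-trans (m∣m*n c) (≡.subst (_∣ e) d≡ d∣e))
        y = go c (rec c<d) (∣-trans (n∣m*n (p ℕ.^ suc a)) (≡.subst (_∣ e) d≡ d∣e))

  -- For an element g of order e, the unit x and the powers g^0, ..., g^(e - 1) are e + 1 entries
  -- among e units. Two powers cannot coincide, so x meets one of them.
  generator : ∃ λ g → IsGenerator F g
  generator with element-of-order e ∣-refl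
  ... | g , gᵉ≈1 , order = g , g≉0 , λ x x≉0 → log x x≉0
    where
    g≉0 : ¬ g ≈ 0#
    g≉0 = ^≈1⇒nonzero e {{e≢0}} gᵉ≈1
    module _ x (x≉0 : ¬ x ≈ 0#) where
      f : Fin (suc e) → Fin e
      f zero    = unitIndex x≉0
      f (suc i) = unitIndex (^-nonzero (toℕ i) g≉0)
      log : ∃ λ i → pow F g i ≈ x
      log with Fin.pigeonhole (ℕ.n<1+n e) f
      ... | zero , suc j , _ , eq = toℕ j , (begin
        pow F g (toℕ j)                        ≡⟨ pow≡^ g (toℕ j) ⟩
        g ^ toℕ j                              ≈⟨ unit-unitIndex (^-nonzero (toℕ j) g≉0) ⟨
        unit (f (suc j))                       ≡⟨ ≡.cong unit eq ⟨
        unit (unitIndex x≉0)                   ≈⟨ unit-unitIndex x≉0 ⟩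
        x                                      ∎)
      ... | suc i , suc j , s≤s i<j , eq = ⊥-elim (ℕ.<⇒≱ (ℕ.≤-<-trans (ℕ.m∸n≤m (toℕ j) (toℕ i)) (Fin.toℕ<n j))
        (∣⇒≤ {{≢-nonZero (ℕ.m>n⇒m∸n≢0 i<j)}} (order _ (^-cancel (toℕ i) _ g≉0 (begin
          g ^ (toℕ i ℕ.+ (toℕ j ∸ toℕ i))      ≡⟨ ≡.cong (g ^_) (ℕ.m+[n∸m]≡n (ℕ.<⇒≤ i<j)) ⟩
          g ^ toℕ j                            ≈⟨ unit-unitIndex (^-nonzero (toℕ j) g≉0) ⟨
          unit (f (suc j))                     ≡⟨ ≡.cong unit eq ⟨
          unit (f (suc i))                     ≈⟨ unit-unitIndex (^-nonzero (toℕ i) g≉0) ⟩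
          g ^ toℕ i                            ∎)))))

-- The quotient ring as a ring of operators on sequences

-- Operators commuting with everything that commutes with the shift: they commute with one
-- another, and comparing them only at a cyclic vector u presents K[x]/Ann(u), where x is the shift.
module Operators (K : CommutativeRing 0ℓ 0ℓ) (u : ℕ → CommutativeRing.Carrier K) where
  open CommutativeRing K hiding (zero)
  open import Relation.Binary.Reasoning.Setoid setoid

  infix 4 _≋_
  _≋_ : (v w : ℕ → Carrier) → Set
  v ≋ w = ∀ j → v j ≈ w j

  record Linear (h : (ℕ → Carrier) → ℕ → Carrier) : Set where
    field
      cong  : ∀ {v w} → v ≋ w → h v ≋ h w
      add   : ∀ v w → h (λ j → v j + w j) ≋ λ j → h v j + h w j
      scale : ∀ c v → h (λ j → c * v j) ≋ λ j → c * h v j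
      shift : ∀ v → h (v ∘ suc) ≋ h v ∘ suc

  -- Centrality is required against all `Linear` maps, a class containing every operator;
  -- quantifying over operators instead would make the record refer to itself negatively.
  record Operator : Set where
    field
      app     : (ℕ → Carrier) → ℕ → Carrier
      linear  : Linear app
      central : ∀ {h} → Linear h → ∀ v → app (h v) ≋ h (app v)
    open Linear linear public

  open Operator

  scalar : Carrier → Operator
  scalar c = record
    { app     = λ v j → c * v j
    ; linear  = record
      { cong  = λ h j → *-congˡ (h j)
      ; add   = λ v w j → distribˡ c (v j) (w j)
      ; scale = λ d v j → trans (sym (*-assoc c d (v j))) (trans (*-congʳ (*-comm c d)) (*-assoc d c (v j)))
      ; shift = λ v j → refl
      }
    ; central = λ lin v j → sym (Linear.scale lin c v j)
    }

  shiftOp : Operator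
  shiftOp = record
    { app     = λ v → v ∘ suc
    ; linear  = record
      { cong = λ h → h ∘ suc ; add = λ v w j → refl ; scale = λ c v j → refl ; shift = λ v j → refl }
    ; central = λ lin v j → sym (Linear.shift lin v j)
    }

  _⊕_ : Operator → Operator → Operator
  S ⊕ T = record
    { app     = λ v j → app S v j + app T v j
    ; linear  = record
      { cong  = λ h j → +-cong (cong S h j) (cong T h j)
      ; add   = λ v w j → trans (+-cong (add S v w j) (add T v w j)) (interchange _ _ _ _)
      ; scale = λ c v j → trans (+-cong (scale S c v j) (scale T c v j)) (sym (distribˡ c _ _))
      ; shift = λ v j → +-cong (shift S v j) (shift T v j)
      }
    ; central = λ lin v j → trans (+-cong (central S lin v j) (central T lin v j))
                                  (sym (Linear.add lin _ _ j))
    }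
    where open import Algebra.Properties.CommutativeSemigroup +-commutativeSemigroup using (interchange)

  _⊛_ : Operator → Operator → Operator
  S ⊛ T = record
    { app     = λ v → app S (app T v)
    ; linear  = record
      { cong  = λ h → cong S (cong T h)
      ; add   = λ v w j → trans (cong S (add T v w) j) (add S _ _ j)
      ; scale = λ c v j → trans (cong S (scale T c v) j) (scale S c _ j)
      ; shift = λ v j → trans (cong S (shift T v) j) (shift S _ j)
      }
    ; central = λ lin v j → trans (cong S (central T lin v) j) (central S lin _ j)
    }

  _≈ₒ_ : Operator → Operator → Set
  S ≈ₒ T = app S u ≋ app T u

  ⊛-comm : ∀ S T v → app S (app T v) ≋ app T (app S v)
  ⊛-comm S T = central S (linear T)

  operatorRing : CommutativeRing 0ℓ 0ℓ
  operatorRing = record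
    { Carrier = Operator ; _≈_ = _≈ₒ_ ; _+_ = _⊕_ ; _*_ = _⊛_ ; -_ = scalar (- 1#) ⊛_
    ; 0# = scalar 0# ; 1# = scalar 1#
    ; isCommutativeRing = record
      { isRing = record
        { +-isAbelianGroup = record
          { isGroup = record
            { isMonoid = record
              { isSemigroup = record
                { isMagma = record
                  { isEquivalence = record
                    { refl = λ _ → refl ; sym = λ h j → sym (h j) ; trans = λ h h′ j → trans (h j) (h′ j) }
                  ; ∙-cong = λ h h′ j → +-cong (h j) (h′ j) }
                ; assoc = λ S T W j → +-assoc _ _ _ }
              ; identity = (λ T j → trans (+-congʳ (zeroˡ _)) (+-identityˡ _))
                         , (λ T j → trans (+-congˡ (zeroˡ _)) (+-identityʳ _)) }
            ; inverse = (λ T j → trans (negˡ (app T u j)) (sym (zeroˡ _)))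
                      , (λ T j → trans (+-comm _ _) (trans (negˡ (app T u j)) (sym (zeroˡ _))))
            ; ⁻¹-cong = λ h j → *-congˡ (h j) }
          ; comm = λ S T j → +-comm _ _ }
        ; *-cong = λ {S} {S′} {T} {T′} → ⊛-cong S S′ T T′
        ; *-assoc = λ S T W j → refl
        ; *-identity = (λ T j → *-identityˡ _)
                     , (λ T j → cong T (λ i → *-identityˡ (u i)) j)
        ; distrib = (λ S T W j → add S _ _ j) , (λ S T W j → refl) }
      ; *-comm = λ S T j → ⊛-comm S T u j } }
    where
    negˡ : ∀ x → - 1# * x + x ≈ 0#
    negˡ x = begin
      - 1# * x + x        ≈⟨ +-congˡ (*-identityˡ x) ⟨
      - 1# * x + 1# * x   ≈⟨ distribʳ x (- 1#) 1# ⟨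
      (- 1# + 1#) * x     ≈⟨ *-congʳ (-‿inverseˡ 1#) ⟩
      0# * x              ≈⟨ zeroˡ x ⟩
      0#                  ∎
    -- Agreement is known only at u, so S is first moved past T′ in order to act on u itself.
    -- Commutativity thus makes the product well defined.
    ⊛-cong : ∀ S S′ T T′ → S ≈ₒ S′ → T ≈ₒ T′ → (S ⊛ T) ≈ₒ (S′ ⊛ T′)
    ⊛-cong S S′ T T′ S≈S′ T≈T′ j = begin
      app S (app T u) j    ≈⟨ cong S T≈T′ j ⟩
      app S (app T′ u) j   ≈⟨ ⊛-comm S T′ u j ⟩
      app T′ (app S u) j   ≈⟨ cong T′ S≈S′ j ⟩
      app T′ (app S′ u) j  ≈⟨ ⊛-comm T′ S′ u j ⟩
      app S′ (app T′ u) j  ∎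

-- Algebras over F and the q-power map

record Hom (K R : CommutativeRing 0ℓ 0ℓ) : Set where
  private
    module K = CommutativeRing K
    module R = CommutativeRing R
  field
    ι      : K.Carrier → R.Carrier
    ι-cong : ∀ {x y} → x K.≈ y → ι x R.≈ ι y
    ι-+    : ∀ x y → ι (x K.+ y) R.≈ ι x R.+ ι y
    ι-*    : ∀ x y → ι (x K.* y) R.≈ ι x R.* ι y
    ι-0    : ι K.0# R.≈ R.0#
    ι-1    : ι K.1# R.≈ R.1#

-- The expansion of (c + z)^m is needed in F itself, to identify its coefficients for m = q, before
-- it is used in an algebra.
idHom : ∀ K → Hom K K
idHom K = record { ι = id ; ι-cong = id ; ι-+ = λ _ _ → refl ; ι-* = λ _ _ → refl ; ι-0 = refl ; ι-1 = refl }
  where open CommutativeRing K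

module Power (K : CommutativeRing 0ℓ 0ℓ) where
  open CommutativeRing K hiding (zero)

  -- The coefficients of (c + X)ᵐ.
  powerCoeff : Carrier → ℕ → ℕ → Carrier
  powerCoeff c zero    zero    = 1#
  powerCoeff c zero    (suc i) = 0#
  powerCoeff c (suc m) zero    = c * powerCoeff c m zero
  powerCoeff c (suc m) (suc i) = c * powerCoeff c m (suc i) + powerCoeff c m i

  powerCoeff-> : ∀ c m i → m < i → powerCoeff c m i ≈ 0#
  powerCoeff-> c zero    (suc i) _         = refl
  powerCoeff-> c (suc m) (suc i) (s≤s m<i) = trans
    (+-cong (trans (*-congˡ (powerCoeff-> c m (suc i) (ℕ.m≤n⇒m≤1+n m<i))) (zeroʳ c)) (powerCoeff-> c m i m<i))
    (+-identityʳ 0#)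

  powerCoeff-top : ∀ c m → powerCoeff c m m ≈ 1#
  powerCoeff-top c zero    = refl
  powerCoeff-top c (suc m) = trans
    (+-cong (trans (*-congˡ (powerCoeff-> c m (suc m) ℕ.≤-refl)) (zeroʳ c)) (powerCoeff-top c m))
    (+-identityˡ 1#)

module HomProperties {K R : CommutativeRing 0ℓ 0ℓ} (hom : Hom K R) where
  open Hom hom public
  open Power K
  private
    module K where
      open CommutativeRing K public
      open Polynomials K public
      open import Algebra.Properties.CommutativeSemiring.Exp commutativeSemiring public
  open CommutativeRing R hiding (zero)
  open Polynomials R
  open import Algebra.Properties.CommutativeSemiring.Exp commutativeSemiring
  open import Algebra.Solver.Ring.NaturalCoefficients.Default commutativeSemiring
  open import Relation.Binary.Reasoning.Setoid setoid

  ι-^ : ∀ x n → ι (x K.^ n) ≈ ι x ^ n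
  ι-^ x zero    = ι-1
  ι-^ x (suc n) = trans (ι-* x _) (*-congˡ (ι-^ x n))

  ι-conv : ∀ A B i → ι (K.conv A B i) ≈ conv (ι ∘ A) (ι ∘ B) i
  ι-conv A B i = ι-sumTo i
    where
    ι-sumTo : ∀ m → ι (K.sumTo m (λ j → A j K.* B (i ∸ j))) ≈ sumTo m (λ j → ι (A j) * ι (B (i ∸ j)))
    ι-sumTo zero    = ι-* _ _
    ι-sumTo (suc m) = trans (ι-+ _ _) (+-cong (ι-sumTo m) (ι-* _ _))

  eval-power : ∀ c m z → eval (suc m) (ι ∘ powerCoeff c m) z ≈ (ι c + z) ^ m
  eval-power c zero    z = trans (+-cong ι-1 (zeroʳ z)) (+-identityʳ 1#)
  eval-power c (suc m) z = begin
    ι (c K.* p 0) + z * eval (suc m) (λ i → ι (c K.* p (suc i) K.+ p i)) z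
      ≈⟨ +-cong (ι-* c (p 0)) (*-congˡ (eval-cong (suc m)
           (λ i _ → trans (ι-+ (c K.* p (suc i)) (p i)) (+-congʳ (ι-* c (p (suc i))))) refl)) ⟩
    ι c * ι (p 0) + z * eval (suc m) (λ i → ι c * ι (p (suc i)) + ι (p i)) z
      ≈⟨ +-congˡ (*-congˡ (eval-linear (suc m) (ι ∘ p ∘ suc) (ι ∘ p) (ι c) z)) ⟩
    ι c * ι (p 0) + z * (ι c * eval (suc m) (ι ∘ p ∘ suc) z + w)
      ≈⟨ solve 5 (λ c p z e w → c :* p :+ z :* (c :* e :+ w) := c :* (p :+ z :* e) :+ z :* w)
           refl (ι c) (ι (p 0)) z _ w ⟩
    ι c * eval (suc (suc m)) (ι ∘ p) z + z * w
      ≈⟨ +-congʳ (*-congˡ (eval-extend 1 (suc m) (ι ∘ p) z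
           (λ j m<j → trans (ι-cong (powerCoeff-> c m j m<j)) ι-0))) ⟩
    ι c * w + z * w
      ≈⟨ distribʳ w (ι c) z ⟨
    (ι c + z) * w
      ≈⟨ *-congˡ (eval-power c m z) ⟩
    (ι c + z) ^ suc m ∎
    where
    p = powerCoeff c m
    w = eval (suc m) (ι ∘ p) z

  -- The top term is set apart because q roots kill a polynomial with q coefficients, while (c +
  -- X)^q has q + 1.
  eval-power-split : ∀ c m z → eval m (ι ∘ powerCoeff c m) z + z ^ m ≈ (ι c + z) ^ m
  eval-power-split c m z = begin
    eval m (ι ∘ powerCoeff c m) z + z ^ m
      ≈⟨ +-congˡ (trans (*-congʳ (trans (ι-cong (powerCoeff-top c m)) ι-1)) (*-identityˡ _)) ⟨
    eval m (ι ∘ powerCoeff c m) z + ι (powerCoeff c m m) * z ^ m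
      ≈⟨ eval-last m _ z ⟨
    eval (suc m) (ι ∘ powerCoeff c m) z
      ≈⟨ eval-power c m z ⟩
    (ι c + z) ^ m ∎

module LowerCoefficients (F : Field) {e : ℕ} (size : HasSize F (suc e)) where
  open FiniteField F size
  open Power commRing
  open HomProperties (idHom commRing) using (eval-power-split)
  open import Relation.Binary.Reasoning.Setoid setoid

  -- (c + X)^q − X^q − c has degree < q and vanishes at all q elements of F,
  -- so it is zero as a polynomial; hence (c + z)^q = c + z^q in every F-algebra.
  lowerCoeff : Carrier → ℕ → Carrier
  lowerCoeff c zero    = powerCoeff c (suc e) zero - c
  lowerCoeff c (suc i) = powerCoeff c (suc e) (suc i)

  lowerCoeff-eval : ∀ c z → eval (suc e) (lowerCoeff c) z ≈ 0#
  lowerCoeff-eval c z = begin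
    (p - c) + w     ≈⟨ +-assoc _ _ _ ⟩
    p + (- c + w)   ≈⟨ +-congˡ (+-comm _ _) ⟩
    p + (w - c)     ≈⟨ +-assoc _ _ _ ⟨
    (p + w) - c     ≈⟨ +-congʳ (+-cancelʳ z _ _ p+w+z≈c+z) ⟩
    c - c           ≈⟨ -‿inverseʳ c ⟩
    0#              ∎
    where
    p = powerCoeff c (suc e) zero
    w = z * eval e (powerCoeff c (suc e) ∘ suc) z
    p+w+z≈c+z : (p + w) + z ≈ c + z
    p+w+z≈c+z = begin
      (p + w) + z           ≈⟨ +-congˡ (^q≈id z) ⟨
      (p + w) + z ^ suc e   ≈⟨ eval-power-split c (suc e) z ⟩
      (c + z) ^ suc e       ≈⟨ ^q≈id (c + z) ⟩
      c + z                 ∎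

  lowerCoeff≈0 : ∀ c i → i < suc e → lowerCoeff c i ≈ 0#
  lowerCoeff≈0 c = distinct-roots (suc e) (lowerCoeff c) elem
    (λ {i} {j} i<j z → distinct-cancel λ h → Fin.<⇒≢ i<j (≡.sym (elem-injective j i h)))
    (λ i → lowerCoeff-eval c (elem i))

module Frobenius (F : Field) {e : ℕ} (size : HasSize F (suc e))
                 {R : CommutativeRing 0ℓ 0ℓ} (hom : Hom (Field.commRing F) R) where
  private module F = FieldProperties F
  open Power F.commRing
  open LowerCoefficients F size
  open HomProperties hom
  open CommutativeRing R hiding (zero)
  open Polynomials R
  open import Algebra.Properties.CommutativeSemiring.Exp commutativeSemiring
  open import Relation.Binary.Reasoning.Setoid setoid

  frobenius-+ : ∀ c z → (ι c + z) ^ suc e ≈ ι c + z ^ suc e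
  frobenius-+ c z = begin
    (ι c + z) ^ suc e
      ≈⟨ eval-power-split c (suc e) z ⟨
    (ι (powerCoeff c (suc e) 0) + z * eval e (ι ∘ powerCoeff c (suc e) ∘ suc) z) + z ^ suc e
      ≈⟨ +-congʳ (trans (+-cong
           (ι-cong (F.x∙y⁻¹≈ε⇒x≈y _ _ (lowerCoeff≈0 c 0 (s≤s z≤n))))
           (trans (*-congˡ (eval-0 e (λ i i<e → trans (ι-cong (lowerCoeff≈0 c (suc i) (s≤s i<e))) ι-0))) (zeroʳ z)))
           (+-identityʳ _)) ⟩
    ι c + z ^ suc e ∎

  -- Each Horner step adds a constant of F to a multiple of y, so additivity with one summand from F
  -- suffices. The q-th power of a value is therefore the value at y^q.
  frobenius-eval : ∀ d f y → eval d (ι ∘ f) y ^ suc e ≈ eval d (ι ∘ f) (y ^ suc e)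
  frobenius-eval zero    f y = zeroˡ _
  frobenius-eval (suc d) f y = trans (frobenius-+ (f 0) _)
    (+-congˡ (trans (^-distrib-* y _ (suc e)) (*-congˡ (frobenius-eval d (f ∘ suc) y))))

-- Irreducibility of x^n - g for a generator g

-- An F-algebra containing F[x]/(xⁿ − g) with n = suc m.
record BinomialAlgebra (F : Field) (g : Field.Carrier F) (m : ℕ) : Set₁ where
  private module F = Field F
  field
    R   : CommutativeRing 0ℓ 0ℓ
    hom : Hom F.commRing R
  open CommutativeRing R using (Carrier; _≈_; _*_; 0#; semiring)
  open Exp semiring using (_^_)
  open Polynomials R using (eval)
  open Hom hom using (ι)
  field
    α               : Carrier
    α^n≈g           : α ^ suc m ≈ ι g
    -- The one consequence of the linear independence of 1, α, ..., α^m that the argument uses.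
    top-coefficient : ∀ {c} d f → d ≤ m → ι c * eval (suc d) (ι ∘ f) α ≈ 0# → c F.* f d F.≈ F.0#

module BinomialQuotient (F : Field) (g : Field.Carrier F) (m : ℕ) where
  private module F = FieldProperties F

  -- One period reads 0, ..., 0, 1 and each later period is g times the one before: the impulse
  -- response for x^n - g.
  u-aux : (r d : ℕ) → F.Carrier
  u-aux r d with r ℕ.≟ m
  ... | yes _ = g F.^ d
  ... | no _  = F.0#

  -- A cyclic vector of the recurrence u (j + n) = g u j with n = suc m.
  u : ℕ → F.Carrier
  u i = u-aux (i % suc m) (i ℕ./ suc m)

  u-recurrence : ∀ j → u (j ℕ.+ suc m) F.≈ g F.* u j
  u-recurrence j = F.trans (F.reflexive (≡.cong₂ u-aux (ℕ.[m+n]%n≡m%n j (suc m)) next))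
    (step (j % suc m) (j ℕ./ suc m))
    where
    next : (j ℕ.+ suc m) ℕ./ suc m ≡ suc (j ℕ./ suc m)
    next = ≡.trans (ℕ.+-distrib-/-∣ʳ j (∣-refl {suc m}))
      (≡.trans (≡.cong (j ℕ./ suc m ℕ.+_) (ℕ.n/n≡1 (suc m))) (ℕ.+-comm (j ℕ./ suc m) 1))
    step : ∀ r d → u-aux r (suc d) F.≈ g F.* u-aux r d
    step r d with r ℕ.≟ m
    ... | yes _ = F.refl
    ... | no _  = F.sym (F.zeroʳ g)

  u-<m : ∀ {i} → i < m → u i F.≈ F.0#
  u-<m {i} i<m = F.trans
    (F.reflexive (≡.cong (λ r → u-aux r (i ℕ./ suc m)) (ℕ.m<n⇒m%n≡m (ℕ.m≤n⇒m≤1+n i<m))))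
    (vanish (i ℕ./ suc m))
    where
    vanish : ∀ d → u-aux i d F.≈ F.0#
    vanish d with i ℕ.≟ m
    ... | yes i≡m = ⊥-elim (ℕ.<⇒≢ i<m i≡m)
    ... | no _    = F.refl

  u-m : u m F.≈ F.1#
  u-m = F.trans
    (F.reflexive (≡.cong₂ u-aux (ℕ.m<n⇒m%n≡m (ℕ.n<1+n m)) (ℕ.m<n⇒m/n≡0 (ℕ.n<1+n m)))) one
    where
    one : u-aux m 0 F.≈ F.1#
    one with m ℕ.≟ m
    ... | yes _  = F.refl
    ... | no m≢m = ⊥-elim (m≢m ≡.refl)

  open Operators F.commRing u
  open Operator

  R : CommutativeRing 0ℓ 0ℓ
  R = operatorRing

  open CommutativeRing R using (Carrier; _≈_; _*_; 0#; semiring)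
  open import Algebra.Properties.Semiring.Exp semiring using (_^_)
  open Polynomials R using (eval)

  hom : Hom F.commRing R
  hom = record
    { ι = scalar ; ι-cong = λ h j → F.*-congʳ h ; ι-+ = λ x y j → F.distribʳ (u j) x y
    ; ι-* = λ x y j → F.*-assoc x y (u j) ; ι-0 = λ _ → F.refl ; ι-1 = λ _ → F.refl }

  α : Carrier
  α = shiftOp

  app-α^ : ∀ k j → app (α ^ k) u j F.≈ u (j ℕ.+ k)
  app-α^ zero    j = F.trans (F.*-identityˡ _) (F.reflexive (≡.cong u (≡.sym (ℕ.+-identityʳ j))))
  app-α^ (suc k) j = F.trans (app-α^ k (suc j)) (F.reflexive (≡.cong u (≡.sym (ℕ.+-suc j k))))

  α^n≈g : α ^ suc m ≈ scalar g
  α^n≈g j = F.trans (app-α^ (suc m) j) (u-recurrence j)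

  -- At position j = m - d the lower coefficients meet zeros of u, and f d meets u m = 1.
  app-eval-top : ∀ d f j → j ℕ.+ d ≡ m → app (eval (suc d) (scalar ∘ f) α) u j F.≈ f d
  app-eval-top zero    f j j+d≡m = F.trans
    (F.+-cong (F.*-congˡ (F.trans (F.reflexive (≡.cong u (≡.trans (≡.sym (ℕ.+-identityʳ j)) j+d≡m))) u-m))
              (F.zeroˡ _))
    (F.trans (F.+-identityʳ _) (F.*-identityʳ _))
  app-eval-top (suc d) f j j+d≡m = F.trans
    (F.+-cong (F.trans (F.*-congˡ (u-<m (≡.subst (j <_) j+d≡m (ℕ.m<m+n j (s≤s z≤n))))) (F.zeroʳ _))
              (app-eval-top d (f ∘ suc) (suc j) (≡.trans (≡.sym (ℕ.+-suc j d)) j+d≡m)))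
    (F.+-identityˡ _)

  top-coefficient : ∀ {c} d f → d ≤ m → scalar c * eval (suc d) (scalar ∘ f) α ≈ 0# → c F.* f d F.≈ F.0#
  top-coefficient {c} d f d≤m h = F.trans (F.*-congˡ (F.sym (app-eval-top d f (m ∸ d) (ℕ.m∸n+n≡m d≤m))))
    (F.trans (h (m ∸ d)) (F.zeroˡ _))

  binomialAlgebra : BinomialAlgebra F g m
  binomialAlgebra = record
    { R = R ; hom = hom ; α = α ; α^n≈g = α^n≈g ; top-coefficient = top-coefficient }

module Irreducibility (F : Field) {e : ℕ} (size : HasSize F (suc e))
                      {g : Field.Carrier F} (gen : IsGenerator F g)
                      (m : ℕ) (adm : Admissible (suc m) e)
                      (algebra : BinomialAlgebra F g m) where
  private
    module F = FiniteField F size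
    q = suc e
    n = suc m
  open BinomialAlgebra algebra
  open HomProperties hom
  open Frobenius F size hom
  open CommutativeRing R hiding (zero)
  open Polynomials R
  open import Algebra.Properties.CommutativeSemiring.Exp commutativeSemiring
  open import Algebra.Solver.Ring.NaturalCoefficients.Default commutativeSemiring
  open import Relation.Binary.Reasoning.Setoid setoid

  g≉0 : ¬ g F.≈ F.0#
  g≉0 = proj₁ gen

  ι-regular : ∀ {c z} → ¬ c F.≈ F.0# → ι c * z ≈ 0# → z ≈ 0#
  ι-regular {c} {z} c≉0 h with F.inverse c c≉0
  ... | d , cd≈1 = begin
    z                 ≈⟨ *-identityˡ z ⟨
    1# * z            ≈⟨ *-congʳ (trans (ι-cong (F.trans (F.*-comm d c) cd≈1)) ι-1) ⟨
    ι (d F.* c) * z   ≈⟨ *-congʳ (ι-* d c) ⟩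
    ι d * ι c * z     ≈⟨ *-assoc _ _ _ ⟩
    ι d * (ι c * z)   ≈⟨ *-congˡ h ⟩
    ι d * 0#          ≈⟨ zeroʳ _ ⟩
    0#                ∎

  ι-fix : ∀ {c z} → ¬ c F.≈ F.1# → ι c * z ≈ z → z ≈ 0#
  ι-fix {c} {z} c≉1 h = ι-regular (λ e → c≉1 (F.x∙y⁻¹≈ε⇒x≈y c F.1# e)) (begin
    ι (c F.- F.1#) * z               ≈⟨ *-congʳ (ι-+ c (F.- F.1#)) ⟩
    (ι c + ι (F.- F.1#)) * z         ≈⟨ distribʳ z _ _ ⟩
    ι c * z + ι (F.- F.1#) * z       ≈⟨ +-congʳ (trans h (trans (sym (*-identityˡ z)) (*-congʳ (sym ι-1)))) ⟩
    ι F.1# * z + ι (F.- F.1#) * z    ≈⟨ distribʳ z _ _ ⟨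
    (ι F.1# + ι (F.- F.1#)) * z      ≈⟨ *-congʳ (ι-+ F.1# (F.- F.1#)) ⟨
    ι (F.1# F.- F.1#) * z            ≈⟨ *-congʳ (trans (ι-cong (F.-‿inverseʳ F.1#)) ι-0) ⟩
    0# * z                           ≈⟨ zeroˡ z ⟩
    0#                               ∎)

  α⁻¹ : Carrier
  α⁻¹ = ι (proj₁ (F.inverse g g≉0)) * α ^ m

  α⁻¹*α≈1 : α⁻¹ * α ≈ 1#
  α⁻¹*α≈1 = begin
    ι h * α ^ m * α     ≈⟨ *-assoc _ _ _ ⟩
    ι h * (α ^ m * α)   ≈⟨ *-congˡ (*-comm _ _) ⟩
    ι h * α ^ n         ≈⟨ *-congˡ α^n≈g ⟩
    ι h * ι g           ≈⟨ ι-* h g ⟨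
    ι (h F.* g)         ≈⟨ ι-cong (F.trans (F.*-comm h g) (proj₂ (F.inverse g g≉0))) ⟩
    ι F.1#              ≈⟨ ι-1 ⟩
    1#                  ∎
    where h = proj₁ (F.inverse g g≉0)

  α^-cancel : ∀ s {x y} → α ^ s * x ≈ α ^ s * y → x ≈ y
  α^-cancel s {x} {y} h = trans (sym (undo x)) (trans (*-congˡ h) (undo y))
    where
    undo : ∀ x → α⁻¹ ^ s * (α ^ s * x) ≈ x
    undo x = begin
      α⁻¹ ^ s * (α ^ s * x)  ≈⟨ *-assoc _ _ _ ⟨
      α⁻¹ ^ s * α ^ s * x    ≈⟨ *-congʳ (^-distrib-* α⁻¹ α s) ⟨
      (α⁻¹ * α) ^ s * x      ≈⟨ *-congʳ (trans (^-congˡ s α⁻¹*α≈1) (1^n≈1 s)) ⟩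
      1# * x                 ≈⟨ *-identityˡ x ⟩
      x                      ∎

  α^n* : ∀ k → α ^ (n ℕ.* k) ≈ ι (g F.^ k)
  α^n* k = trans (sym (^-assocʳ α n k)) (trans (^-congˡ k α^n≈g) (sym (ι-^ g k)))

  coprime-q : Coprime n q
  coprime-q = no-common-prime⇒coprime λ p pp p∣n p∣q →
    prime∤1 pp (∣m+n∣m⇒∣n (≡.subst (p ∣_) (ℕ.+-comm 1 e) p∣q) (proj₁ adm p pp p∣n))

  n∣q^k*⇒n∣ : ∀ k {x} → n ∣ q ℕ.^ k ℕ.* x → n ∣ x
  n∣q^k*⇒n∣ zero    h = ≡.subst (n ∣_) (ℕ.*-identityˡ _) h
  n∣q^k*⇒n∣ (suc k) h = n∣q^k*⇒n∣ k (coprime-divisor coprime-q (≡.subst (n ∣_) (ℕ.*-assoc q (q ℕ.^ k) _) h))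

  -- The root of unity α has order exactly n e: if z is fixed by a smaller power of α^e,
  -- then it is fixed by a power g^(e/p) ≠ 1.
  fixed⇒≈0 : ∀ {z} x → ¬ n ∣ x → α ^ (e ℕ.* x) * z ≈ z → z ≈ 0#
  fixed⇒≈0 {z} x n∤x h = go (gcd[m,n]∣m n x)
    where
    d = gcd n x
    δ = α ^ e
    δⁿ : δ ^ n * z ≈ z
    δⁿ = begin
      (α ^ e) ^ n * z       ≈⟨ *-congʳ (^-assocʳ α e n) ⟩
      α ^ (e ℕ.* n) * z     ≡⟨ ≡.cong (λ k → α ^ k * z) (ℕ.*-comm e n) ⟩
      α ^ (n ℕ.* e) * z     ≈⟨ *-congʳ (trans (α^n* e) (trans (ι-cong (F.fermat g≉0)) ι-1)) ⟩
      1# * z                ≈⟨ *-identityˡ z ⟩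
      z                     ∎
    δᵈ : δ ^ d * z ≈ z
    δᵈ = ^-fix-gcd n x δⁿ (trans (*-congʳ (^-assocʳ α e x)) h)
    rearrange : ∀ a p b d → a ℕ.* p ℕ.* (b ℕ.* d) ≡ b ℕ.* p ℕ.* d ℕ.* a
    rearrange = solve-∀
    go : d ∣ n → z ≈ 0#
    go (divides c n≡c*d) = by-prime (prime-divisor c {{c≢0}} c≢1)
      where
      c≢1 : c ≢ 1
      c≢1 ≡.refl = n∤x (≡.subst (_∣ x) (≡.trans (≡.sym (ℕ.+-identityʳ d)) (≡.sym n≡c*d)) (gcd[m,n]∣n n x))
      c≢0 : NonZero c
      c≢0 = ≢-nonZero λ where ≡.refl → ℕ.1+n≢0 n≡c*d
      by-prime : ∃ (λ p → Prime p × p ∣ c) → z ≈ 0#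
      by-prime (p , pp , divides c′ c≡) = by-quotient (proj₁ adm p pp
          (divides (c′ ℕ.* d) (≡.trans n≡c*d (≡.trans (≡.cong (ℕ._* d) c≡) (swap c′ p d)))))
        where
        swap : ∀ a b c → a ℕ.* b ℕ.* c ≡ a ℕ.* c ℕ.* b
        swap = solve-∀
        by-quotient : p ∣ e → z ≈ 0#
        by-quotient (divides e′ e≡) = ι-fix g^e′≉1 (begin
          ι (g F.^ e′) * z               ≈⟨ *-congʳ (α^n* e′) ⟨
          α ^ (n ℕ.* e′) * z             ≡⟨ ≡.cong (λ k → α ^ k * z) exponents ⟨
          α ^ (e ℕ.* (c′ ℕ.* d)) * z     ≈⟨ *-congʳ (^-assocʳ α e (c′ ℕ.* d)) ⟨
          δ ^ (c′ ℕ.* d) * z             ≈⟨ ^-fix-* d c′ δᵈ ⟩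
          z                              ∎)
          where
          -- Here c′ d = n/p and e′ = e/p, so both sides are n e/p: a power of α^e becomes a power
          -- of g.
          exponents : e ℕ.* (c′ ℕ.* d) ≡ n ℕ.* e′
          exponents = ≡.trans (≡.cong (ℕ._* (c′ ℕ.* d)) e≡) (≡.trans (rearrange e′ p c′ d)
            (≡.cong (ℕ._* e′) (≡.sym (≡.trans n≡c*d (≡.cong (ℕ._* d) c≡)))))
          e′≢0 : NonZero e′
          e′≢0 = ≢-nonZero λ where ≡.refl → ℕ.≢-nonZero⁻¹ e {{F.e≢0}} e≡
          e′<e : e′ < e
          e′<e = ≡.subst (e′ <_) (≡.sym e≡) (ℕ.m<m*n e′ p {{e′≢0}} (nonTrivial⇒n>1 p {{prime⇒nonTrivial pp}}))
          g^e′≉1 : ¬ g F.^ e′ F.≈ F.1#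
          g^e′≉1 h = ℕ.<⇒≱ e′<e (F.generator-order gen e′ {{e′≢0}} h)

  -- After cancelling the unit α^(q^k), the exponent left over is q^k (q^l - 1) = e q^k `geom q l`.
  -- If n divided q^k `geom q l` it would divide l, since n is prime to q, but 0 < l < n.
  conjugates-distinct : ∀ k l .{{_ : NonZero l}} → l < n → ∀ z →
    α ^ (q ℕ.^ (k ℕ.+ l)) * z ≈ α ^ (q ℕ.^ k) * z → z ≈ 0#
  conjugates-distinct k l l<n z h = fixed⇒≈0 (q ℕ.^ k ℕ.* geom q l)
    (λ n∣ → ℕ.<⇒≱ l<n (∣⇒≤ (admissible∧∣geom⇒∣ n e l adm (n∣q^k*⇒n∣ k n∣))))
    (α^-cancel (q ℕ.^ k) (begin
      α ^ Q * (α ^ (e ℕ.* (Q ℕ.* G)) * z)  ≈⟨ *-assoc _ _ _ ⟨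
      α ^ Q * α ^ (e ℕ.* (Q ℕ.* G)) * z    ≈⟨ *-congʳ (^-homo-* α Q _) ⟨
      α ^ (Q ℕ.+ e ℕ.* (Q ℕ.* G)) * z      ≡⟨ ≡.cong (λ k → α ^ k * z) exponents ⟨
      α ^ (q ℕ.^ (k ℕ.+ l)) * z            ≈⟨ h ⟩
      α ^ Q * z                            ∎))
    where
    Q = q ℕ.^ k
    G = geom q l
    distribute : ∀ Q e G → Q ℕ.* suc (e ℕ.* G) ≡ Q ℕ.+ e ℕ.* (Q ℕ.* G)
    distribute = solve-∀
    exponents : q ℕ.^ (k ℕ.+ l) ≡ Q ℕ.+ e ℕ.* (Q ℕ.* G)
    exponents = ≡.trans (ℕ.^-distribˡ-+-* q k l)
      (≡.trans (≡.cong (Q ℕ.*_) (^-geom e l)) (distribute Q e G))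

  module _ (a b : ℕ) (a+b≡n : a ℕ.+ b ≡ n) (1≤a : 1 ≤ a) (1≤b : 1 ≤ b) (A B : ℕ → F.Carrier)
           (degA : ∀ j → a < j → A j F.≈ F.0#) (degB : ∀ j → b < j → B j F.≈ F.0#)
           (constant : F.conv A B 0 F.≈ F.- g) (leading : F.conv A B n F.≈ F.1#)
           (middle : ∀ i → i < m → F.conv A B (suc i) F.≈ F.0#) where

    β : Carrier
    β = eval (suc b) (ι ∘ B) α

    private
      A∙B : ℕ → Carrier
      A∙B = conv (ι ∘ A) (ι ∘ B)
      ιA : ∀ j → suc a ≤ j → ι (A j) ≈ 0#
      ιA j a<j = trans (ι-cong (degA j a<j)) ι-0
      ιB : ∀ j → suc b ≤ j → ι (B j) ≈ 0#
      ιB j b<j = trans (ι-cong (degB j b<j)) ι-0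

    A[α]β≈0 : eval (suc a) (ι ∘ A) α * β ≈ 0#
    A[α]β≈0 = begin
      eval (suc a) (ι ∘ A) α * β
        ≈⟨ eval-conv (suc a) (suc b) (ι ∘ A) (ι ∘ B) α ιA ιB ⟨
      eval (suc a ℕ.+ suc b) A∙B α
        ≡⟨ ≡.cong (λ k → eval k A∙B α) (≡.cong suc (≡.trans (ℕ.+-suc a b) (≡.cong suc a+b≡n))) ⟩
      eval (suc (suc n)) A∙B α
        -- `eval-conv` counts (a + 1) + (b + 1) = n + 2 coefficients, one more than x^n - g has.
        ≈⟨ eval-extend 1 (suc n) A∙B α (λ j n<j → conv-degree (suc a) (suc b) (ι ∘ A) (ι ∘ B) j
             (s≤s (≡.subst (_≤ j) (≡.sym (≡.trans (ℕ.+-suc a b) (≡.cong suc a+b≡n))) n<j)) ιA ιB) ⟩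
      eval (suc n) A∙B α
        ≈⟨ eval-binomial m {A∙B}
             (trans (sym (ι-conv A B 0)) (ι-cong constant))
             (trans (sym (ι-conv A B n)) (trans (ι-cong leading) ι-1))
             (λ i i<m → trans (sym (ι-conv A B (suc i))) (trans (ι-cong (middle i i<m)) ι-0)) ⟩
      ι (F.- g) + 1# * α ^ n
        ≈⟨ +-congˡ (trans (*-identityˡ _) α^n≈g) ⟩
      ι (F.- g) + ι g
        ≈⟨ ι-+ (F.- g) g ⟨
      ι (F.- g F.+ g)
        ≈⟨ ι-cong (F.-‿inverseˡ g) ⟩
      ι F.0#
        ≈⟨ ι-0 ⟩
      0# ∎

    -- The value of A at the next conjugate is the q-th power of the value E at this one, and E β =
    -- 0 gives E^q β = 0.
    A[conjugate]β≈0 : ∀ k → eval (suc a) (ι ∘ A) (α ^ (q ℕ.^ k)) * β ≈ 0#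
    A[conjugate]β≈0 zero    = trans (*-congʳ (eval-cong (suc a) {ι ∘ A} (λ _ _ → refl) (*-identityʳ α))) A[α]β≈0
    A[conjugate]β≈0 (suc k) = begin
      eval (suc a) (ι ∘ A) (α ^ (q ℕ.* q ℕ.^ k)) * β
        ≈⟨ *-congʳ (eval-cong (suc a) {ι ∘ A} (λ _ _ → refl)
             (trans (^-congʳ α (ℕ.*-comm q (q ℕ.^ k))) (sym (^-assocʳ α (q ℕ.^ k) q)))) ⟩
      eval (suc a) (ι ∘ A) ((α ^ (q ℕ.^ k)) ^ q) * β
        ≈⟨ *-congʳ (frobenius-eval (suc a) A (α ^ (q ℕ.^ k))) ⟨
      E * E ^ e * β
        ≈⟨ solve 3 (λ x y z → x :* y :* z := y :* (x :* z)) refl E (E ^ e) β ⟩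
      E ^ e * (E * β)
        ≈⟨ *-congˡ (A[conjugate]β≈0 k) ⟩
      E ^ e * 0#
        ≈⟨ zeroʳ _ ⟩
      0# ∎
      where E = eval (suc a) (ι ∘ A) (α ^ (q ℕ.^ k))

    a<n : a < n
    a<n = ≡.subst (a <_) a+b≡n (ℕ.m<m+n a 1≤b)

    -- A has degree a but the a + 1 roots α^(q^k), k ≤ a, at which its values annihilate β.
    A-leading*β≈0 : ι (A a) * β ≈ 0#
    A-leading*β≈0 = distinct-roots (suc a) (λ i → ι (A i) * β) (λ i → α ^ (q ℕ.^ toℕ i))
      (λ {i} {j} i<j z h → conjugates-distinct (toℕ i) (toℕ j ∸ toℕ i) {{≢-nonZero (ℕ.m>n⇒m∸n≢0 i<j)}}
        (ℕ.≤-<-trans (ℕ.m∸n≤m (toℕ j) (toℕ i)) (ℕ.<-≤-trans (Fin.toℕ<n j) a<n)) z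
        (trans (*-congʳ (^-congʳ α (≡.cong (q ℕ.^_) (ℕ.m+[n∸m]≡n (ℕ.<⇒≤ i<j))))) h))
      (λ i → trans (eval-*ʳ (suc a) (ι ∘ A) β _) (A[conjugate]β≈0 (toℕ i)))
      a ℕ.≤-refl

    -- The degree bounds reduce the coefficient of x^n in A B to A_a B_b. Since A_a β = 0 and B_b is
    -- the coefficient of β at degree b ≤ m, this product is 0 instead of 1.
    no-factorization : ⊥
    no-factorization = F.0≉1 (F.trans (F.sym (F.sumTo-0 n term)) leading)
      where
      b≤m : b ≤ m
      b≤m = ℕ.s≤s⁻¹ (≡.subst (b <_) a+b≡n (ℕ.m<n+m b 1≤a))
      term : ∀ j → j ≤ n → A j F.* B (n ∸ j) F.≈ F.0#
      term j j≤n with ℕ.<-cmp j a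
      ... | tri> _ _ a<j = F.trans (F.*-congʳ (degA j a<j)) (F.zeroˡ _)
      ... | tri≈ _ ≡.refl _ = F.trans
        (F.*-congˡ (F.reflexive (≡.cong B (≡.trans (≡.cong (_∸ a) (≡.sym a+b≡n)) (ℕ.m+n∸m≡n a b)))))
        (top-coefficient b B b≤m A-leading*β≈0)
      ... | tri< j<a _ _ = F.trans (F.*-congˡ (degB (n ∸ j)
        (ℕ.+-cancelˡ-< j b (n ∸ j) (≡.subst (j ℕ.+ b <_) (≡.trans a+b≡n (≡.sym (ℕ.m+[n∸m]≡n j≤n)))
          (ℕ.+-monoˡ-< b j<a))))) (F.zeroʳ _)

-- Explicit factorizations of binomials

module Shift (K : CommutativeRing 0ℓ 0ℓ) where
  open CommutativeRing K hiding (zero)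
  open Polynomials K

  private
    Poly : Set
    Poly = ℕ → Carrier

  DegreeAtMost : ℕ → Poly → Set
  DegreeAtMost d A = ∀ j → d < j → A j ≈ 0#

  one : Poly
  one zero    = 1#
  one (suc _) = 0#

  X^_·_ : ℕ → Poly → Poly
  (X^ zero  · A) i       = A i
  (X^ suc k · A) zero    = 0#
  (X^ suc k · A) (suc i) = (X^ k · A) i

  X^-cong : ∀ k {A B : Poly} → (∀ i → A i ≈ B i) → ∀ i → (X^ k · A) i ≈ (X^ k · B) i
  X^-cong zero    h i       = h i
  X^-cong (suc k) h zero    = refl
  X^-cong (suc k) h (suc i) = X^-cong k h i

  X^-linear : ∀ k c (A B : Poly) i →
    (X^ k · (λ j → c * A j + B j)) i ≈ c * (X^ k · A) i + (X^ k · B) i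
  X^-linear zero    c A B i       = refl
  X^-linear (suc k) c A B zero    = sym (trans (+-identityʳ _) (zeroʳ c))
  X^-linear (suc k) c A B (suc i) = X^-linear k c A B i

  X^-+ : ∀ k l A i → (X^ (k ℕ.+ l) · A) i ≈ (X^ k · (X^ l · A)) i
  X^-+ zero    l A i       = refl
  X^-+ (suc k) l A zero    = refl
  X^-+ (suc k) l A (suc i) = X^-+ k l A i

  X^-degree : ∀ k {d A} → DegreeAtMost d A → DegreeAtMost (k ℕ.+ d) (X^ k · A)
  X^-degree zero    h j       d<j       = h j d<j
  X^-degree (suc k) h (suc j) (s≤s d<j) = X^-degree k h j d<j

  one-degree : DegreeAtMost 0 one
  one-degree (suc j) _ = refl

  linear-degree : ∀ {d A B} c → DegreeAtMost d A → DegreeAtMost d B →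
    DegreeAtMost d (λ j → c * A j + B j)
  linear-degree c hA hB j d<j =
    trans (+-cong (trans (*-congˡ (hA j d<j)) (zeroʳ c)) (hB j d<j)) (+-identityʳ 0#)

  degree-mono : ∀ {d d′ A} → d ≤ d′ → DegreeAtMost d A → DegreeAtMost d′ A
  degree-mono d≤d′ h j d′<j = h j (ℕ.≤-<-trans d≤d′ d′<j)

  conv-one : ∀ B i → conv one B i ≈ B i
  conv-one B zero    = *-identityˡ _
  conv-one B (suc i) = trans (conv-suc one B i)
    (trans (+-cong (*-identityˡ _) (sumTo-0 i (λ j _ → zeroˡ _))) (+-identityʳ _))

  conv-X^ : ∀ k A B i → conv (X^ k · A) B i ≈ (X^ k · conv A B) i
  conv-X^ zero    A B i       = refl
  conv-X^ (suc k) A B zero    = zeroˡ _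
  conv-X^ (suc k) A B (suc i) = trans (conv-suc (X^ suc k · A) B i)
    (trans (+-cong (zeroˡ _) (conv-X^ k A B i)) (+-identityˡ _))

  conv-X^-one : ∀ k B i → conv (X^ k · one) B i ≈ (X^ k · B) i
  conv-X^-one k B i = trans (conv-X^ k one B i) (X^-cong k (conv-one B) i)

  binomial : ℕ → Carrier → Poly
  binomial n g i with i ℕ.≟ 0 | i ℕ.≟ n
  ... | yes _ | _     = - g
  ... | no _  | yes _ = 1#
  ... | no _  | no _  = 0#

  X^-one-≡ : ∀ n → (X^ n · one) n ≈ 1#
  X^-one-≡ zero    = refl
  X^-one-≡ (suc n) = X^-one-≡ n

  X^-one-≢ : ∀ n i → i ≢ n → (X^ n · one) i ≈ 0#
  X^-one-≢ zero    zero    h = ⊥-elim (h ≡.refl)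
  X^-one-≢ zero    (suc i) h = refl
  X^-one-≢ (suc n) zero    h = refl
  X^-one-≢ (suc n) (suc i) h = X^-one-≢ n i (λ i≡n → h (≡.cong suc i≡n))

  -- The case distinction is traded for a linear combination of shifts of `one`, on which the
  -- linearity lemmas act.
  binomial-X^ : ∀ n g i → n ≢ 0 → - g * one i + (X^ n · one) i ≈ binomial n g i
  binomial-X^ n g i n≢0 with i ℕ.≟ 0 | i ℕ.≟ n
  ... | yes ≡.refl | _ = trans (+-cong (*-identityʳ _) (X^-one-≢ n 0 (n≢0 ∘ ≡.sym))) (+-identityʳ _)
  ... | no i≢0 | yes ≡.refl = trans (+-cong (trans (*-congˡ (X^-one-≢ 0 i i≢0)) (zeroʳ _)) (X^-one-≡ n)) (+-identityˡ _)
  ... | no i≢0 | no i≢n = trans (+-cong (trans (*-congˡ (X^-one-≢ 0 i i≢0)) (zeroʳ _)) (X^-one-≢ n i i≢n)) (+-identityˡ _)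

  record Factorization (n : ℕ) (g : Carrier) : Set where
    field
      a b     : ℕ
      A B     : Poly
      1≤a     : 1 ≤ a
      1≤b     : 1 ≤ b
      a+b≡n   : a ℕ.+ b ≡ n
      degA    : DegreeAtMost a A
      degB    : DegreeAtMost b B
      product : ∀ i → conv A B i ≈ binomial n g i

module ExplicitFactorizations (F : Field) where
  open FieldProperties F
  open Shift commRing public
  open import Algebra.Solver.Ring.NaturalCoefficients.Default commutativeSemiring
  open import Relation.Binary.Reasoning.Setoid setoid

  -- The coefficients of (Xᵖ − hᵖ) / (X − h) for X = xᵐ.
  geometric : ℕ → Carrier → ℕ → ℕ → Carrier
  geometric m h zero    i = 0#
  geometric m h (suc p) i = h ^ p * one i + (X^ m · geometric m h p) i

  -- The definition splits off the constant term, this expansion the top term; comparing the two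
  -- yields (X - h) G = X^p - h^p.
  geometric-suc : ∀ m h p i → geometric m h (suc p) i ≈ h * geometric m h p i + (X^ (p ℕ.* m) · one) i
  geometric-suc m h zero    i = begin
    1# * one i + (X^ m · (λ _ → 0#)) i  ≈⟨ +-cong (*-identityˡ _) (X^-0 m i) ⟩
    one i + 0#                          ≈⟨ +-comm _ _ ⟩
    0# + one i                          ≈⟨ +-congʳ (zeroʳ h) ⟨
    h * 0# + one i                      ∎
    where
    X^-0 : ∀ m i → (X^ m · (λ _ → 0#)) i ≈ 0#
    X^-0 zero    i       = refl
    X^-0 (suc m) zero    = refl
    X^-0 (suc m) (suc i) = X^-0 m i
  geometric-suc m h (suc p) i = begin
    h * h ^ p * o + (X^ m · geometric m h (suc p)) i
      ≈⟨ +-congˡ (X^-cong m (geometric-suc m h p) i) ⟩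
    h * h ^ p * o + (X^ m · (λ j → h * geometric m h p j + (X^ (p ℕ.* m) · one) j)) i
      ≈⟨ +-congˡ (X^-linear m h _ _ i) ⟩
    h * h ^ p * o + (h * (X^ m · geometric m h p) i + (X^ m · (X^ (p ℕ.* m) · one)) i)
      ≈⟨ solve 5 (λ h t o x y → h :* t :* o :+ (h :* x :+ y) := h :* (t :* o :+ x) :+ y) refl h (h ^ p) o _ _ ⟩
    h * geometric m h (suc p) i + (X^ m · (X^ (p ℕ.* m) · one)) i
      ≈⟨ +-congˡ (X^-+ m (p ℕ.* m) one i) ⟨
    h * geometric m h (suc p) i + (X^ (suc p ℕ.* m) · one) i ∎
    where o = one i

  geometric-degree : ∀ m h p → DegreeAtMost (p ℕ.* m) (geometric m h (suc p))
  geometric-degree m h zero    j 0<j = trans (geometric-suc m h zero j)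
    (trans (+-cong (zeroʳ h) (one-degree j 0<j)) (+-identityʳ _))
  geometric-degree m h (suc p) = linear-degree _ (degree-mono z≤n one-degree)
    (X^-degree m (geometric-degree m h p))

  -- The factor x^m - h is split off. An exponent of at least 2 keeps the cofactor nonconstant.
  power-factorization : ∀ {g} h p m .{{_ : NonZero m}} → h ^ suc (suc p) ≈ g →
    Factorization (suc (suc p) ℕ.* m) g
  power-factorization {g} h p m hᵖ≈g = record
    { a = m ; b = suc p ℕ.* m ; A = A ; B = G (suc (suc p))
    ; 1≤a = ℕ.>-nonZero⁻¹ m ; 1≤b = ℕ.>-nonZero⁻¹ _ {{ℕ.m*n≢0 (suc p) m}} ; a+b≡n = ≡.refl
    ; degA = linear-degree (- h) (degree-mono z≤n one-degree)
        (≡.subst (λ d → DegreeAtMost d (X^ m · one)) (ℕ.+-identityʳ m) (X^-degree m one-degree))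
    ; degB = geometric-degree m h (suc p)
    ; product = λ i → trans (product i)
        (binomial-X^ (P ℕ.* m) g i (ℕ.≢-nonZero⁻¹ _ {{ℕ.m*n≢0 P m}}))
    }
    where
    P = suc (suc p)
    G = geometric m h
    A : ℕ → Carrier
    A j = - h * one j + (X^ m · one) j
    product : ∀ i → conv A (G P) i ≈ - g * one i + (X^ (P ℕ.* m) · one) i
    -- Adding g = h^P completes X^m G to the next geometric sum, whose other expansion cancels - h
    -- G.
    product i = +-cancelˡ (g * o) _ _ (begin
      g * o + conv A (G P) i
        ≈⟨ +-congˡ (conv-linearˡ (- h) one _ (G P) i) ⟩
      g * o + (- h * conv one (G P) i + conv (X^ m · one) (G P) i)
        ≈⟨ +-cong (*-congʳ (sym hᵖ≈g)) (+-cong (*-congˡ (conv-one (G P) i)) (conv-X^-one m (G P) i)) ⟩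
      h ^ P * o + (- h * G P i + (X^ m · G P) i)
        ≈⟨ solve 3 (λ x y z → x :+ (y :+ z) := y :+ (x :+ z)) refl _ _ _ ⟩
      - h * G P i + G (suc P) i
        ≈⟨ +-congˡ (geometric-suc m h P i) ⟩
      - h * G P i + (h * G P i + x)
        ≈⟨ cancel h (G P i) x ⟩
      x
        ≈⟨ cancel g o x ⟨
      - g * o + (g * o + x)
        ≈⟨ solve 3 (λ x y z → x :+ (y :+ z) := y :+ (x :+ z)) refl _ _ _ ⟩
      g * o + (- g * o + x) ∎)
      where
      o = one i
      x = (X^ (P ℕ.* m) · one) i
      cancel : ∀ h y x → - h * y + (h * y + x) ≈ x
      cancel h y x = begin
        - h * y + (h * y + x)    ≈⟨ +-assoc _ _ _ ⟨
        (- h * y + h * y) + x    ≈⟨ +-congʳ (distribʳ y (- h) h) ⟨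
        (- h + h) * y + x        ≈⟨ +-congʳ (trans (*-congʳ (-‿inverseˡ h)) (zeroˡ y)) ⟩
        0# + x                   ≈⟨ +-identityˡ x ⟩
        x                        ∎

  -- X⁴ + h² = (X² + s X + h)(X² − s X + h) when s² = 2h.
  quartic-factorization : ∀ {g} h s m .{{_ : NonZero m}} → h * h ≈ - g → s * s ≈ h + h →
    Factorization (4 ℕ.* m) g
  quartic-factorization {g} h s m h²≈-g s²≈2h = record
    { a = m ℕ.+ m ; b = m ℕ.+ m ; A = T s ; B = T (- s)
    ; 1≤a = 1≤2m ; 1≤b = 1≤2m ; a+b≡n = lem m
    ; degA = T-degree s ; degB = T-degree (- s)
    ; product = λ i → trans (product i)
        (binomial-X^ (4 ℕ.* m) g i (ℕ.≢-nonZero⁻¹ _ {{ℕ.m*n≢0 4 m}}))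
    }
    where
    lem : ∀ m → m ℕ.+ m ℕ.+ (m ℕ.+ m) ≡ 4 ℕ.* m
    lem = solve-∀
    1≤2m : 1 ≤ m ℕ.+ m
    1≤2m = ℕ.≤-trans (ℕ.>-nonZero⁻¹ m) (ℕ.m≤m+n m m)
    x¹ x² : ℕ → Carrier
    x¹ = X^ m · one
    x² = X^ m · x¹
    T : Carrier → ℕ → Carrier
    T s j = h * one j + (s * x¹ j + x² j)
    x¹-degree : DegreeAtMost m x¹
    x¹-degree = ≡.subst (λ d → DegreeAtMost d x¹) (ℕ.+-identityʳ m) (X^-degree m one-degree)
    T-degree : ∀ s → DegreeAtMost (m ℕ.+ m) (T s)
    T-degree s = linear-degree h (degree-mono z≤n one-degree)
      (linear-degree s (degree-mono (ℕ.m≤m+n m m) x¹-degree) (X^-degree m x¹-degree))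
    X^-T : ∀ k t i → (X^ k · T t) i ≈ h * (X^ k · one) i + (t * (X^ k · x¹) i + (X^ k · x²) i)
    X^-T k t i = trans (X^-linear k h one _ i) (+-congˡ (X^-linear k t x¹ x² i))
    product : ∀ i → conv (T s) (T (- s)) i ≈ - g * one i + (X^ (4 ℕ.* m) · one) i
    product i = begin
      conv (T s) B i
        ≈⟨ trans (conv-linearˡ h one _ B i) (+-congˡ (conv-linearˡ s x¹ x² B i)) ⟩
      h * conv one B i + (s * conv x¹ B i + conv x² B i)
        ≈⟨ +-cong (*-congˡ (conv-one B i)) (+-cong (*-congˡ (conv-X^-one m B i))
             (trans (conv-X^ m x¹ B i) (X^-cong m (conv-X^-one m B) i))) ⟩
      h * B i + (s * (X^ m · B) i + (X^ m · (X^ m · B)) i)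
        ≈⟨ +-congˡ (+-cong (*-congˡ (X^-T m (- s) i))
             (trans (X^-cong m (X^-T m (- s)) i)
               (trans (X^-linear m h x¹ _ i) (+-congˡ (X^-linear m (- s) x² x³ i))))) ⟩
      h * (h * o + (- s * x¹ i + x² i)) +
        (s * (h * x¹ i + (- s * x² i + x³ i)) + (h * x² i + (- s * x³ i + x⁴ i)))
        -- In this semiring identity - s is a free variable t. The odd powers collect s + t, and x²
        -- collects 2h + s t; both vanish at t = - s.
        ≈⟨ solve 8 (λ h s t o x y z w →
             h :* (h :* o :+ (t :* x :+ y)) :+ (s :* (h :* x :+ (t :* y :+ z)) :+ (h :* y :+ (t :* z :+ w)))
             := (h :* h :* o :+ w) :+ ((s :+ t) :* (h :* x :+ z) :+ (h :+ h :+ s :* t) :* y))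
             refl h s (- s) o (x¹ i) (x² i) (x³ i) (x⁴ i) ⟩
      (h * h * o + x⁴ i) + ((s + - s) * (h * x¹ i + x³ i) + (h + h + s * - s) * x² i)
        ≈⟨ +-cong (+-cong (*-congʳ h²≈-g) x⁴≈) (+-cong
             (trans (*-congʳ (-‿inverseʳ s)) (zeroˡ _)) (trans (*-congʳ middle≈0) (zeroˡ _))) ⟩
      (- g * o + (X^ (4 ℕ.* m) · one) i) + (0# + 0#)
        ≈⟨ trans (+-congˡ (+-identityʳ 0#)) (+-identityʳ _) ⟩
      - g * o + (X^ (4 ℕ.* m) · one) i ∎
      where
      B = T (- s)
      o = one i
      x³ x⁴ : ℕ → Carrier
      x³ = X^ m · x²
      x⁴ = X^ m · x³
      middle≈0 : h + h + s * - s ≈ 0#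
      middle≈0 = trans (+-congʳ (sym s²≈2h)) (trans (sym (distribˡ s s (- s)))
        (trans (*-congˡ (-‿inverseʳ s)) (zeroʳ s)))
      x⁴≈ : x⁴ i ≈ (X^ (4 ℕ.* m) · one) i
      x⁴≈ = sym (begin
        (X^ (4 ℕ.* m) · one) i                      ≡⟨ ≡.cong (λ k → (X^ k · one) i) (lem′ m) ⟩
        (X^ (m ℕ.+ (m ℕ.+ (m ℕ.+ m))) · one) i      ≈⟨ X^-+ m _ one i ⟩
        (X^ m · (X^ (m ℕ.+ (m ℕ.+ m)) · one)) i     ≈⟨ X^-cong m (λ j → trans (X^-+ m _ one j)
                                                         (X^-cong m (X^-+ m m one) j)) i ⟩
        x⁴ i                                        ∎)
        where
        lem′ : ∀ m → 4 ℕ.* m ≡ m ℕ.+ (m ℕ.+ (m ℕ.+ m))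
        lem′ = solve-∀

-- Reducibility when admissibility fails

module Reducibility (F : Field) {e : ℕ} (size : HasSize F (suc e)) where
  open FiniteField F size
  open ExplicitFactorizations F
  open import Relation.Binary.Reasoning.Setoid setoid

  -- On a group of order e, raising to a power prime to e is inverted by a Bézout coefficient; when
  -- that coefficient is negative, it is applied to g⁻¹.
  coprime-root : ∀ p → Coprime (suc p) e → ∀ g → ∃ λ h → h ^ suc p ≈ g
  coprime-root p cop g with g ≈? 0#
  ... | yes g≈0 = 0# , trans (zeroˡ _) (sym g≈0)
  ... | no g≉0 with coprime-Bézout cop
  ...   | Bézout.+- x y eq = g ^ x , (begin
    (g ^ x) ^ suc p         ≈⟨ ^-assocʳ g x (suc p) ⟩
    g ^ (x ℕ.* suc p)       ≡⟨ ≡.cong (g ^_) eq ⟨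
    g * g ^ (y ℕ.* e)       ≈⟨ *-congˡ (^∣≈1 g e (fermat g≉0) (n∣m*n y)) ⟩
    g * 1#                  ≈⟨ *-identityʳ g ⟩
    g                       ∎)
  ...   | Bézout.-+ x y eq with inverse g g≉0
  ...     | g⁻¹ , gg⁻¹≈1 = g⁻¹ ^ x , (begin
    (g⁻¹ ^ x) ^ suc p         ≈⟨ ^-assocʳ g⁻¹ x (suc p) ⟩
    g⁻¹ ^ r                   ≈⟨ *-identityˡ _ ⟨
    1# * g⁻¹ ^ r              ≈⟨ *-congʳ (^∣≈1 g e (fermat g≉0) (divides y eq)) ⟨
    g * g ^ r * g⁻¹ ^ r       ≈⟨ *-assoc _ _ _ ⟩
    g * (g ^ r * g⁻¹ ^ r)     ≈⟨ *-congˡ (^-distrib-* g g⁻¹ r) ⟨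
    g * (g * g⁻¹) ^ r         ≈⟨ *-congˡ (trans (^-congˡ r gg⁻¹≈1) (1^n≈1 r)) ⟩
    g * 1#                    ≈⟨ *-identityʳ g ⟩
    g                         ∎)
    where r = x ℕ.* suc p

  square≈1 : ∀ {w} → w * w ≈ 1# → w ≈ 1# ⊎ w ≈ - 1#
  square≈1 {w} h with w ≈? 1#
  ... | yes w≈1 = inj₁ w≈1
  ... | no w≉1  = inj₂ (+-cancelˡ 1# _ _ (trans (*-cancel-0 (λ e → w≉1 (x∙y⁻¹≈ε⇒x≈y w 1# e)) (begin
    (w - 1#) * (1# + w)                ≈⟨ distribˡ _ _ _ ⟩
    (w - 1#) * 1# + (w - 1#) * w       ≈⟨ +-cong (*-identityʳ _) ([y-z]x≈yx-zx w w 1#) ⟩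
    (w - 1#) + (w * w - 1# * w)        ≈⟨ +-congˡ (+-cong h (-‿cong (*-identityˡ w))) ⟩
    (w - 1#) + (1# - w)                ≈⟨ +-assoc _ _ _ ⟩
    w + (- 1# + (1# - w))              ≈⟨ +-congˡ (+-assoc _ _ _) ⟨
    w + ((- 1# + 1#) - w)              ≈⟨ +-congˡ (trans (+-congʳ (-‿inverseˡ 1#)) (+-identityˡ _)) ⟩
    w - w                              ≈⟨ -‿inverseʳ w ⟩
    0#                                 ∎)) (sym (-‿inverseʳ 1#))))

  -- Since e = 2 (2t + 1), the square of s = x^(t + 1) is x w with w = x^(e/2), and w² = x^e = 1
  -- forces w = ±1.
  square-up-to-sign : ∀ t → e ≡ suc (t ℕ.* 2) ℕ.* 2 → ∀ x → ∃ λ s → s * s ≈ x ⊎ s * s ≈ - x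
  square-up-to-sign t e≡ x with x ≈? 0#
  ... | yes x≈0 = 0# , inj₁ (trans (zeroˡ 0#) (sym x≈0))
  ... | no x≉0 = s , sign (square≈1 w²≈1)
    where
    s = x ^ suc t
    w = x ^ suc (t ℕ.* 2)
    w²≈1 : w * w ≈ 1#
    w²≈1 = begin
      w * w                          ≈⟨ *-congˡ (*-identityʳ w) ⟨
      w ^ 2                          ≈⟨ ^-assocʳ x (suc (t ℕ.* 2)) 2 ⟩
      x ^ (suc (t ℕ.* 2) ℕ.* 2)      ≡⟨ ≡.cong (x ^_) e≡ ⟨
      x ^ e                          ≈⟨ fermat x≉0 ⟩
      1#                             ∎
    s²≈ : s * s ≈ x * w
    s²≈ = trans (*-congˡ (sym (*-identityʳ s))) (^-assocʳ x (suc t) 2)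
    sign : w ≈ 1# ⊎ w ≈ - 1# → s * s ≈ x ⊎ s * s ≈ - x
    sign (inj₁ w≈1)  = inj₁ (trans s²≈ (trans (*-congˡ w≈1) (*-identityʳ x)))
    sign (inj₂ w≈-1) = inj₂ (trans s²≈ (trans (*-congˡ w≈-1)
      (trans (sym (-‿distribʳ-* x 1#)) (-‿cong (*-identityʳ x)))))

  factor-coprime : ∀ {n p} .{{_ : NonZero n}} → Prime p → p ∣ n → ¬ p ∣ e → ∀ g → Factorization n g
  factor-coprime {p = suc (suc p)} pp (divides m ≡.refl) p∤e g =
    ≡.subst (λ n → Factorization n g) (ℕ.*-comm (suc (suc p)) m)
      (power-factorization (proj₁ root) p m {{ℕ.m*n≢0⇒m≢0 m}} (proj₂ root))
    where
    root = coprime-root (suc p) (prime∤⇒coprime pp p∤e) g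

  factor-quartic : ∀ {n} .{{_ : NonZero n}} t → 4 ∣ n → e ≡ suc (t ℕ.* 2) ℕ.* 2 → ∀ g → Factorization n g
  factor-quartic t (divides m ≡.refl) e≡ g = ≡.subst (λ n → Factorization n g) (ℕ.*-comm 4 m) go
    where
    instance m≢0 = ℕ.m*n≢0⇒m≢0 m {4}
    go : Factorization (4 ℕ.* m) g
    go with square-up-to-sign t e≡ g
    ... | s , inj₁ s²≈g = ≡.subst (λ n → Factorization n g) (lem m)
      (power-factorization s 0 (2 ℕ.* m) {{ℕ.m*n≢0 2 m}} (trans (*-congˡ (*-identityʳ s)) s²≈g))
      where lem : ∀ m → 2 ℕ.* (2 ℕ.* m) ≡ 4 ℕ.* m
            lem = solve-∀
    ... | h , inj₂ h²≈-g with square-up-to-sign t e≡ (h + h)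
    ...   | s , inj₁ s²≈2h  = quartic-factorization h s m h²≈-g s²≈2h
    -- Now 2 (- h) is the square, and - h has the same square as h.
    ...   | s , inj₂ s²≈-2h = quartic-factorization (- h) s m
      (trans (sym (-‿distribˡ-* h (- h))) (trans (-‿cong (sym (-‿distribʳ-* h h)))
        (trans (-‿involutive _) h²≈-g)))
      (trans s²≈-2h (sym (-‿+-comm h h)))

  -- A violating prime divides n, hence is at most n, so a finite search decides the alternative,
  -- independently of g.
  admissible-or-factor : ∀ n .{{_ : NonZero n}} → Admissible n e ⊎ (∀ g → Factorization n g)
  admissible-or-factor n with Fin.any? {suc n} (λ i → prime? (toℕ i) ×-dec (toℕ i ∣? n) ×-dec ¬? (toℕ i ∣? e))
  ... | yes (i , pp , p∣n , p∤e) = inj₂ (factor-coprime pp p∣n p∤e)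
  ... | no none = go (4 ∣? n) (4 ∣? e)
    where
    primes : ∀ p → Prime p → p ∣ n → p ∣ e
    primes p pp p∣n = decidable-stable (p ∣? e) λ p∤e → none
      (fromℕ< (s≤s (∣⇒≤ p∣n)) , ≡.subst (λ p → Prime p × p ∣ n × ¬ p ∣ e)
        (≡.sym (Fin.toℕ-fromℕ< (s≤s (∣⇒≤ p∣n)))) (pp , p∣n , p∤e))
    go : Dec (4 ∣ n) → Dec (4 ∣ e) → Admissible n e ⊎ (∀ g → Factorization n g)
    go (no 4∤n)  _         = inj₁ (primes , λ 4∣n → ⊥-elim (4∤n 4∣n))
    go (yes _)   (yes 4∣e) = inj₁ (primes , λ _ → 4∣e)
    -- The prime 2 divides n, hence e, while 4 does not: e is twice an odd number.
    go (yes 4∣n) (no 4∤e)  = inj₂ (half (primes 2 prime[2] (∣-trans (divides 2 ≡.refl) 4∣n)))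
      where
      half : 2 ∣ e → ∀ g → Factorization n g
      half (divides k e≡) = parity (k % 2) (ℕ.m%n<n k 2) (ℕ.m≡m%n+[m/n]*n k 2)
        where
        parity : ∀ r → r < 2 → k ≡ r ℕ.+ k ℕ./ 2 ℕ.* 2 → ∀ g → Factorization n g
        parity 0 _ k≡ = ⊥-elim (4∤e (divides (k ℕ./ 2)
          (≡.trans e≡ (≡.trans (≡.cong (ℕ._* 2) k≡) (ℕ.*-assoc (k ℕ./ 2) 2 2)))))
        parity 1 _ k≡ = factor-quartic (k ℕ./ 2) 4∣n (≡.trans e≡ (≡.cong (ℕ._* 2) k≡))
        parity (suc (suc _)) (s≤s (s≤s ()))

-- Transfer along the ultrafilter

module UltrafilterProperties (U : Ultrafilter) where
  open Ultrafilter U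

  -- A set in U is not empty, but no element of it is at hand; decidability of P removes the
  -- resulting double negation.
  ∈U-consistent : ∀ {S} {P : Set} → Dec P → S ∈U → (∀ k → S k → P) → P
  ∈U-consistent P? S∈U h = decidable-stable P? λ ¬P → nonempty (upward (λ k Sk → ¬P (h k Sk)) S∈U)

  ∈U-bounded-∀ : ∀ N (P : ℕ → ℕ → Set) → (∀ i → P i ∈U) → (λ k → ∀ i → i ≤ N → P i k) ∈U
  ∈U-bounded-∀ zero    P h = upward (λ { k p .0 z≤n → p }) (h 0)
  ∈U-bounded-∀ (suc N) P h = upward extend (inter (∈U-bounded-∀ N P h) (h (suc N)))
    where
    extend : ∀ k → (∀ i → i ≤ N → P i k) × P (suc N) k → ∀ i → i ≤ suc N → P i k
    extend k (below , top) i i≤ with ℕ.m≤n⇒m<n∨m≡n i≤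
    ... | inj₁ (s≤s i≤N) = below i i≤N
    ... | inj₂ ≡.refl    = top

  -- The largest remaining value is either taken on a set in U or excluded on one, and finitely many
  -- such decisions settle the value.
  ∈U-bounded-value : ∀ N (d : ℕ → ℕ) → (λ k → d k ≤ N) ∈U → ∃ λ a → (λ k → d k ≡ a) ∈U
  ∈U-bounded-value zero    d h = 0 , upward (λ k → ℕ.n≤0⇒n≡0) h
  ∈U-bounded-value (suc N) d h with ultra (λ k → d k ≡ suc N)
  ... | inj₁ eq = suc N , eq
  ... | inj₂ ne = ∈U-bounded-value N d
    (upward (λ k (d≤ , d≢) → ℕ.s≤s⁻¹ (ℕ.≤∧≢⇒< d≤ d≢)) (inter h ne))

hasSize-suc : ∀ F {q} → HasSize F q → HasSize F (suc (q ∸ 1))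
hasSize-suc F {zero}  (_ , _ , surj) = ⊥-elim (Fin.¬Fin0 (proj₁ (surj (Field.0# F))))
hasSize-suc F {suc q} size = size

module _ (F : Field) where
  open Field F using (_≈_; 0#; Carrier; refl; sym; trans)
  open ExplicitFactorizations F
  open FieldProperties F using (conv; conv-cong)

  -- Each coefficient beyond the degree vanishes on its own set in U, and only finitely many of
  -- these sets can be intersected. Truncation restores the full degree bound at a single index.
  truncate : ℕ → (ℕ → Carrier) → ℕ → Carrier
  truncate a A j with j ℕ.≤? a
  ... | yes _ = A j
  ... | no _  = 0#

  truncate-degree : ∀ a A → DegreeAtMost a (truncate a A)
  truncate-degree a A j a<j with j ℕ.≤? a
  ... | yes j≤a = ⊥-elim (ℕ.<⇒≱ a<j j≤a)
  ... | no _    = refl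

  truncate-≈ : ∀ a A {N} → (∀ j → j ≤ N → a < j → A j ≈ 0#) → ∀ j → j ≤ N → truncate a A j ≈ A j
  truncate-≈ a A h j j≤N with j ℕ.≤? a
  ... | yes _  = refl
  ... | no j≰a = sym (h j j≤N (ℕ.≰⇒> j≰a))

  binomial-top : ∀ m g → binomial (suc m) g (suc m) ≈ Field.1# F
  binomial-top m g with suc m ℕ.≟ suc m
  ... | yes _ = refl
  ... | no ≢  = ⊥-elim (≢ ≡.refl)

  binomial-middle : ∀ m g i → i < m → binomial (suc m) g (suc i) ≈ 0#
  binomial-middle m g i i<m with suc i ℕ.≟ suc m
  ... | yes i≡m = ⊥-elim (ℕ.<⇒≢ i<m (ℕ.suc-injective i≡m))
  ... | no _    = refl

  -- The coefficients of A B up to n involve only those of A and B up to n, so finitely many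
  -- conditions suffice, as a set in U can provide.
  generator-irreducible : ∀ {e} → HasSize F (suc e) → ∀ {g} → IsGenerator F g →
    ∀ m → Admissible (suc m) e → ∀ a b → 1 ≤ a → 1 ≤ b → a ℕ.+ b ≡ suc m → ∀ A B →
    (∀ j → j ≤ suc m → a < j → A j ≈ 0#) → (∀ j → j ≤ suc m → b < j → B j ≈ 0#) →
    (∀ i → i ≤ suc m → conv A B i ≈ binomial (suc m) g i) → ⊥
  generator-irreducible size {g} gen m adm a b 1≤a 1≤b a+b≡n A B degA degB product =
    Irreducibility.no-factorization F size gen m adm (BinomialQuotient.binomialAlgebra F g m)
      a b a+b≡n 1≤a 1≤b (truncate a A) (truncate b B) (truncate-degree a A) (truncate-degree b B)
      (product′ 0 z≤n)
      (trans (product′ (suc m) ℕ.≤-refl) (binomial-top m g))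
      (λ i i<m → trans (product′ (suc i) (s≤s (ℕ.<⇒≤ i<m))) (binomial-middle m g i i<m))
    where
    product′ : ∀ i → i ≤ suc m → conv (truncate a A) (truncate b B) i ≈ binomial (suc m) g i
    product′ i i≤n = trans (conv-cong i
      (λ j j≤i → truncate-≈ a A degA j (ℕ.≤-trans j≤i i≤n))
      (λ j j≤i → truncate-≈ b B degB j (ℕ.≤-trans j≤i i≤n))) (product i i≤n)

module UltraproductBinomials (U : Ultrafilter) (F : ℕ → Field) where
  open Ultrafilter U
  open UltrafilterProperties U
  open Ultraproduct U F
  private module K (k : ℕ) where
    open Field (F k) public using (_≈_; 0#; Carrier; refl; sym; trans; reflexive)
    open ExplicitFactorizations (F k) public
    open FieldProperties (F k) public using (conv; sumTo)

  sumTo-at : ∀ m f k → sumTo m f k ≡ K.sumTo k m (λ j → f j k)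
  sumTo-at zero    f k = ≡.refl
  sumTo-at (suc m) f k = ≡.cong (λ x → Field._+_ (F k) x (f (suc m) k)) (sumTo-at m f k)

  binom-at : ∀ n g i k → binom n g i k ≡ K.binomial k n (g k) i
  binom-at n g i k with i ℕ.≟ 0 | i ℕ.≟ n
  ... | yes _ | _     = ≡.refl
  ... | no _  | yes _ = ≡.refl
  ... | no _  | no _  = ≡.refl

  module _ (q : ℕ → ℕ) (size : ∀ k → HasSize (F k) (q k)) (m : ℕ) where
    private n = suc m

    AdmissibleAt : ℕ → Set
    AdmissibleAt k = Admissible n (q k ∸ 1)

    irreducible-generators : AdmissibleAt ∈U → (g : UP) → (∀ k → IsGenerator (F k) (g k)) →
      IrreducibleBinom n g
    irreducible-generators adm g gen (a , b , A , B , 1≤a , 1≤b , a+b≡n , degA , degB , product) =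
      nonempty (upward (λ k (admₖ , hA , hB , h) →
          generator-irreducible (F k) (hasSize-suc (F k) (size k)) (gen k) m admₖ a b 1≤a 1≤b a+b≡n
            (λ j → A j k) (λ j → B j k) hA hB
            (λ i i≤n → K.trans k (K.reflexive k (≡.sym (sumTo-at i _ k)))
              (K.trans k (h i i≤n) (K.reflexive k (binom-at n g i k)))))
        (inter adm (inter (degree-bound A degA) (inter (degree-bound B degB)
          (∈U-bounded-∀ n _ product)))))
      where
      degree-bound : ∀ {d} (A : Poly) → DegLe A d →
        (λ k → ∀ j → j ≤ n → d < j → K._≈_ k (A j k) (K.0# k)) ∈U
      degree-bound {d} A deg = ∈U-bounded-∀ n _ at
        where
        at : ∀ j → (λ k → d < j → K._≈_ k (A j k) (K.0# k)) ∈U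
        at j with d ℕ.<? j
        ... | yes d<j = upward (λ k h _ → h) (deg j d<j)
        ... | no d≮j  = upward (λ k _ d<j → ⊥-elim (d≮j d<j)) full

    module _ (g : UP) (inadmissible : (λ k → ¬ AdmissibleAt k) ∈U) where
      private
        Outcome : ℕ → Set
        Outcome k = AdmissibleAt k ⊎ K.Factorization k n (g k)

      -- The alternative is decided at every k, so the factors become functions of k without a
      -- choice principle.
      outcome : ∀ k → Outcome k
      outcome k with Reducibility.admissible-or-factor (F k) (hasSize-suc (F k) (size k)) n
      ... | inj₁ adm = inj₁ adm
      ... | inj₂ fac = inj₂ (fac (g k))

      -- Where the condition holds, the degree and the coefficients are junk.
      degree : ∀ {k} → Outcome k → ℕ
      degree (inj₁ _)   = 0
      degree (inj₂ fac) = K.Factorization.a fac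

      left right : ∀ {k} → Outcome k → ℕ → K.Carrier k
      left {k} (inj₁ _)   = λ _ → K.0# k
      left     (inj₂ fac) = K.Factorization.A fac
      right {k} (inj₁ _)   = λ _ → K.0# k
      right     (inj₂ fac) = K.Factorization.B fac

      reducible : Reducible n (binom n g)
      reducible = from-degree (∈U-bounded-value n (λ k → degree (outcome k))
          (upward (λ k ¬adm → bound (outcome k) ¬adm) inadmissible))
        where
        bound : ∀ {k} (o : Outcome k) → ¬ AdmissibleAt k → degree o ≤ n
        bound (inj₁ adm) ¬adm = ⊥-elim (¬adm adm)
        bound (inj₂ fac) ¬adm = ≡.subst (K.Factorization.a fac ≤_) (K.Factorization.a+b≡n fac) (ℕ.m≤m+n _ _)
        from-degree : ∃ (λ a → (λ k → degree (outcome k) ≡ a) ∈U) → Reducible n (binom n g)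
        from-degree (a , a∈U) = a , n ∸ a , (λ j k → left (outcome k) j) , (λ j k → right (outcome k) j) ,
            ∈U-consistent (1 ℕ.≤? a) S∈U (λ k → at₁ (outcome k)) ,
            ∈U-consistent (1 ℕ.≤? n ∸ a) S∈U (λ k → at₂ (outcome k)) ,
            ∈U-consistent (a ℕ.+ (n ∸ a) ℕ.≟ n) S∈U (λ k → at₃ (outcome k)) ,
            (λ j a<j → upward (λ k → at₄ (outcome k) j a<j) S∈U) ,
            (λ j b<j → upward (λ k → at₅ (outcome k) j b<j) S∈U) ,
            λ i → upward (λ k s → K.trans k (K.reflexive k (sumTo-at i _ k))
              (K.trans k (at₆ (outcome k) i s) (K.reflexive k (≡.sym (binom-at n g i k))))) S∈U
          where
          S∈U = inter inadmissible a∈U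
          Good : ∀ {k} → Outcome k → Set
          Good {k} o = ¬ AdmissibleAt k × degree o ≡ a
          codegree : ∀ {k} (fac : K.Factorization k n (g k)) → K.Factorization.a fac ≡ a →
            n ∸ a ≡ K.Factorization.b fac
          codegree fac ≡.refl = ≡.trans (≡.cong (_∸ a) (≡.sym (K.Factorization.a+b≡n fac)))
            (ℕ.m+n∸m≡n a _)
          at₁ : ∀ {k} (o : Outcome k) → Good o → 1 ≤ a
          at₁ (inj₁ adm) (¬adm , _)   = ⊥-elim (¬adm adm)
          at₁ (inj₂ fac) (_ , ≡.refl) = K.Factorization.1≤a fac
          at₂ : ∀ {k} (o : Outcome k) → Good o → 1 ≤ n ∸ a
          at₂ (inj₁ adm) (¬adm , _) = ⊥-elim (¬adm adm)
          at₂ (inj₂ fac) (_ , eq)   = ≡.subst (1 ≤_) (≡.sym (codegree fac eq)) (K.Factorization.1≤b fac)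
          at₃ : ∀ {k} (o : Outcome k) → Good o → a ℕ.+ (n ∸ a) ≡ n
          at₃ o s = ℕ.m+[n∸m]≡n (≡.subst (_≤ n) (proj₂ s) (bound o (proj₁ s)))
          at₄ : ∀ {k} (o : Outcome k) j → a < j → Good o → K._≈_ k (left o j) (K.0# k)
          at₄ (inj₁ adm) j a<j (¬adm , _)   = ⊥-elim (¬adm adm)
          at₄ (inj₂ fac) j a<j (_ , ≡.refl) = K.Factorization.degA fac j a<j
          at₅ : ∀ {k} (o : Outcome k) j → n ∸ a < j → Good o → K._≈_ k (right o j) (K.0# k)
          at₅ (inj₁ adm) j b<j (¬adm , _) = ⊥-elim (¬adm adm)
          at₅ (inj₂ fac) j b<j (_ , eq)   = K.Factorization.degB fac j (≡.subst (_< j) (codegree fac eq) b<j)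
          at₆ : ∀ {k} (o : Outcome k) i → Good o →
            K._≈_ k (K.conv k (left o) (right o) i) (K.binomial k n (g k) i)
          at₆ (inj₁ adm) i (¬adm , _) = ⊥-elim (¬adm adm)
          at₆ (inj₂ fac) i _          = K.Factorization.product fac i

    irreducible⇒admissible : (g : UP) → IrreducibleBinom n g → AdmissibleAt ∈U
    irreducible⇒admissible g irr with ultra AdmissibleAt
    ... | inj₁ adm  = adm
    ... | inj₂ ¬adm = ⊥-elim (irr (reducible g ¬adm))

theorem2p4 : (U : Ultrafilter) → NonPrincipal U →
    (q : ℕ → ℕ) → (∀ k → IsPrimePower (q k)) → TendsToInfinity q →
    (F : ℕ → Field) → (∀ k → HasSize (F k) (q k)) →
    (n : ℕ) → 1 ≤ n →
    ((∀ (g : Ultraproduct.UP U F) → (∀ k → IsGenerator (F k) (g k)) →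
    Ultraproduct.IrreducibleBinom U F n g)
    ⇔ (∃ λ (g : Ultraproduct.UP U F) → Ultraproduct.IrreducibleBinom U F n g))
    ×
    ((∃ λ (g : Ultraproduct.UP U F) → Ultraproduct.IrreducibleBinom U F n g)
    ⇔ Ultrafilter._∈U U (λ k →
    (∀ p → Prime p → p ∣ n → p ∣ q k ∸ 1) × (4 ∣ n → 4 ∣ q k ∸ 1)))
theorem2p4 U _ q _ _ F size (suc m) _ =
    mk⇔ 1⇒2 (3⇒1 ∘ 2⇒3) , mk⇔ 2⇒3 (1⇒2 ∘ 3⇒1)
  where
  open UltraproductBinomials U F
  generators : ∀ k → ∃ λ g → IsGenerator (F k) g
  generators k = FiniteField.generator (F k) (hasSize-suc (F k) (size k))
  -- Without a generator in every field, (1) would hold vacuously and provide no g.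
  1⇒2 = λ h → (λ k → proj₁ (generators k)) , h _ (λ k → proj₂ (generators k))
  2⇒3 = λ (g , irr) → irreducible⇒admissible q size m g irr
  3⇒1 = irreducible-generators q size m
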